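{- Let $\mathsf{C}$ be a category in which idempotents split, let $\mathbf{T}=(T,\eta^{T},\mu^{T})$ and $\mathbf{S}=(S,\eta^{S},\mu^{S})$ be monads on $\mathsf{C}$, and let $G:\mathsf{C}\to\mathsf{C}$ be an endofunctor. Let $\delta: TS\Rightarrow ST$ be a weak distributive law of monads, let $\sigma: TG\Rightarrow GT$ be a weak distributive law of the monad $\mathbf{T}$ over the functor $G$, and let $\tau: SG\Rightarrow GS$ be a weak distributive law of the monad $\mathbf{S}$ over the functor $G$. Assume that the Yang–Baxter condition holds, i.e. the following two natural transformations $TSG\Rightarrow GST$ are equal: $$\tau T\circ S\sigma\circ\delta G \;=\; G\delta\circ\sigma S\circ T\tau .$$ Let $\mathbf{S}\!\mathbf{T}$ be the composite monad on $\mathsf{C}$ induced by $\delta$, with underlying functor denoted $[ST]$, and let $\iota^{*}:[ST]\Rightarrow ST$ and $\pi^{*}:ST\Rightarrow[ST]$ be the associated natural transformations. Then the composite $$\lambda \;=\; G\pi^{*}\circ \tau T\circ S\sigma\circ\iota^{*}G \;:\; [ST]\,G\Rightarrow STG\Rightarrow SGT\Rightarrow GST\Rightarrow G\,[ST]$$ is a weak distributive law of the monad $\mathbf{S}\!\mathbf{T}$ over the functor $G$. Moreover, if $\sigma$ and $\tau$ are strong, then $\lambda$ is strong.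
   Context: Weak distributive laws. For monads $\mathbf{T},\mathbf{S}$ on $\mathsf{C}$, a weak distributive law (of type $\mathbf{T}\mathbf{S}\Rightarrow\mathbf{S}\mathbf{T}$) is a natural transformation $\delta:TS\Rightarrow ST$ such that (i) $\delta\circ\mu^{T}S = S\mu^{T}\circ\delta T\circ T\delta$, (ii) $\delta\circ T\mu^{S}=\mu^{S}T\circ S\delta\circ\delta S$, (iii) $\delta\circ T\eta^{S}=\eta^{S}T$. (The axiom $\delta\circ\eta^{T}S=S\eta^{T}$ is not required.) For a monad $\mathbf{R}=(R,\eta,\mu)$ and an endofunctor $G$ on $\mathsf{C}$, a weak distributive law of $\mathbf{R}$ over $G$ (of type $\mathbf{R}G\Rightarrow G\mathbf{R}$) is a natural transformation $\rho:RG\Rightarrow GR$ with $\rho\circ\mu G=G\mu\circ\rho R\circ R\rho$; it is called strong if moreover $\rho\circ\eta G=G\eta$. Weak liftings. Let $\mathsf{EM}(\mathbf{T})$ be the Eilenberg–Moore category of $\mathbf{T}$, with adjunction $F^{T}\dashv U^{T}$, $U^{T}:\mathsf{EM}(\mathbf{T})\to\mathsf{C}$, and counit $\varepsilon^{T}:F^{T}U^{T}\Rightarrow 1$. A weak lifting of $\mathbf{S}$ on $\mathbf{T}$ is a monad $\widehat{\mathbf{S}}=(\widehat S,\eta^{\widehat S},\mu^{\widehat S})$ on $\mathsf{EM}(\mathbf{T})$ together with natural transformations $\pi:SU^{T}\Rightarrow U^{T}\widehat S$ and $\iota:U^{T}\widehat S\Rightarrow SU^{T}$ such that $\pi\circ\iota=1$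 and $\iota\circ U^{T}\mu^{\widehat S}=\mu^{S}U^{T}\circ S\iota\circ\iota\widehat S$, $\;U^{T}\mu^{\widehat S}\circ\pi\widehat S\circ S\pi=\pi\circ\mu^{S}U^{T}$, $\;\iota\circ U^{T}\eta^{\widehat S}=\eta^{S}U^{T}$, $\;\pi\circ\eta^{S}U^{T}=U^{T}\eta^{\widehat S}$. When idempotents split in $\mathsf{C}$, weak liftings of $\mathbf{S}$ on $\mathbf{T}$ correspond bijectively (up to the choice of splittings) to weak distributive laws $TS\Rightarrow ST$; the weak law corresponding to $(\widehat{\mathbf{S}},\pi,\iota)$ is $$\delta=\iota F^{T}\circ U^{T}\varepsilon^{T}\widehat SF^{T}\circ T\pi F^{T}\circ TS\eta^{T}.$$ (Concretely, for a $\mathbf T$-algebra $(X,x)$, the maps $\pi_{(X,x)},\iota_{(X,x)}$ split the idempotent $Sx\circ\delta_X\circ\eta^T_{SX}$ on $SX$, and the structure map of $\widehat S(X,x)$ is $\pi_{(X,x)}\circ Sx\circ\delta_X\circ T\iota_{(X,x)}$.) Composite monad. Given a weak distributive law $\delta$ with corresponding weak lifting $(\widehat{\mathbf S},\pi,\iota)$, the composite monad $\mathbf{S}\!\mathbf{T}$ on $\mathsf{C}$ is the monad of the composite adjunction $\mathsf{EM}(\widehat{\mathbf S})\rightleftarrows\mathsf{EM}(\mathbf T)\rightleftarrows\mathsf{C}$. Its underlying functor is $[ST]=U^{T}\widehat SF^{T}$, its unit is $U^{T}\eta^{\widehat S}F^{T}\circ\eta^{T}$, and its multiplication is $U^{T}\mu^{\widehat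 S}F^{T}\circ U^{T}\widehat S\,\varepsilon^{T}\widehat SF^{T}$. One sets $\iota^{*}=\iota F^{T}:[ST]\Rightarrow ST$ and $\pi^{*}=\pi F^{T}:ST\Rightarrow[ST]$. -}

module Defs where

open import Level using (Level; _⊔_; suc)
open import Relation.Binary.Bundles using (Setoid)
open import Relation.Binary.Structures using (IsEquivalence)
import Relation.Binary.Reasoning.Setoid as SetoidReasoning

private
  variable
    o ℓ e o′ ℓ′ e′ o″ ℓ″ e″ : Level

infixr 9 _∘F_

record Category (o ℓ e : Level) : Set (suc (o ⊔ ℓ ⊔ e)) where
  infix  4 _≈_ _⇒_
  infixr 9 _∘_
  field
    Obj       : Set o
    _⇒_       : Obj → Obj → Set ℓ
    _≈_       : ∀ {A B} → A ⇒ B → A ⇒ B → Set e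
    id        : ∀ {A} → A ⇒ A
    _∘_       : ∀ {A B C} → B ⇒ C → A ⇒ B → A ⇒ C
    assoc     : ∀ {A B C D} {f : A ⇒ B} {g : B ⇒ C} {h : C ⇒ D} →
                (h ∘ g) ∘ f ≈ h ∘ (g ∘ f)
    identityˡ : ∀ {A B} {f : A ⇒ B} → id ∘ f ≈ f
    identityʳ : ∀ {A B} {f : A ⇒ B} → f ∘ id ≈ f
    equiv     : ∀ {A B} → IsEquivalence (_≈_ {A} {B})
    ∘-resp-≈  : ∀ {A B C} {f h : B ⇒ C} {g i : A ⇒ B} →
                f ≈ h → g ≈ i → f ∘ g ≈ h ∘ i

  module Equiv {A B : Obj} = IsEquivalence (equiv {A} {B})

  hom-setoid : Obj → Obj → Setoid ℓ e
  hom-setoid A B = record { Carrier = A ⇒ B ; _≈_ = _≈_ ; isEquivalence = equiv }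

  module HomReasoning {A B : Obj} = SetoidReasoning (hom-setoid A B)

  ∘-resp-≈ˡ : ∀ {A B C} {f h : B ⇒ C} {g : A ⇒ B} → f ≈ h → f ∘ g ≈ h ∘ g
  ∘-resp-≈ˡ p = ∘-resp-≈ p Equiv.refl

  ∘-resp-≈ʳ : ∀ {A B C} {f : B ⇒ C} {g i : A ⇒ B} → g ≈ i → f ∘ g ≈ f ∘ i
  ∘-resp-≈ʳ p = ∘-resp-≈ Equiv.refl p

  pullˡ : ∀ {A B C D} {f : C ⇒ D} {g : B ⇒ C} {h : B ⇒ D} {k : A ⇒ B} →
          f ∘ g ≈ h → f ∘ (g ∘ k) ≈ h ∘ k
  pullˡ p = Equiv.trans (Equiv.sym assoc) (∘-resp-≈ˡ p)

  pushˡ : ∀ {A B C D} {f : C ⇒ D} {g : B ⇒ C} {h : B ⇒ D} {k : A ⇒ B} →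
          h ≈ f ∘ g → h ∘ k ≈ f ∘ (g ∘ k)
  pushˡ p = Equiv.trans (∘-resp-≈ˡ p) assoc

  extendʳ : ∀ {A B C C′ D} {f : C ⇒ D} {g : B ⇒ C} {h : C′ ⇒ D} {i : B ⇒ C′}
            {k : A ⇒ B} → f ∘ g ≈ h ∘ i → f ∘ (g ∘ k) ≈ h ∘ (i ∘ k)
  extendʳ p = Equiv.trans (pullˡ p) assoc

  cancelˡ : ∀ {A B C} {f : C ⇒ B} {g : B ⇒ C} {k : A ⇒ B} →
            f ∘ g ≈ id → f ∘ (g ∘ k) ≈ k
  cancelˡ p = Equiv.trans (pullˡ p) identityˡ

record Splitting (C : Category o ℓ e) {A : Category.Obj C}
                 (idem : Category._⇒_ C A A) : Set (o ⊔ ℓ ⊔ e) where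
  open Category C
  field
    obj      : Obj
    retract  : A ⇒ obj
    section  : obj ⇒ A
    retracts : retract ∘ section ≈ id
    splits   : section ∘ retract ≈ idem

IdempotentsSplit : Category o ℓ e → Set (o ⊔ ℓ ⊔ e)
IdempotentsSplit C = ∀ {A} (f : A ⇒ A) → f ∘ f ≈ f → Splitting C f
  where open Category C

record Functor (C : Category o ℓ e) (D : Category o′ ℓ′ e′)
               : Set (o ⊔ ℓ ⊔ e ⊔ o′ ⊔ ℓ′ ⊔ e′) where
  private
    module C = Category C
    module D = Category D
  infixl 10 _₀_ _₁_
  field
    _₀_          : C.Obj → D.Obj
    _₁_          : ∀ {A B} → A C.⇒ B → _₀_ A D.⇒ _₀_ B
    identity     : ∀ {A} → _₁_ (C.id {A}) D.≈ D.id
    homomorphism : ∀ {X Y Z} {f : X C.⇒ Y} {g : Y C.⇒ Z} →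
                   _₁_ (g C.∘ f) D.≈ _₁_ g D.∘ _₁_ f
    F-resp-≈     : ∀ {A B} {f g : A C.⇒ B} → f C.≈ g → _₁_ f D.≈ _₁_ g

  F-square : ∀ {A B B′ D} {f : B C.⇒ D} {g : A C.⇒ B} {h : B′ C.⇒ D} {i : A C.⇒ B′} →
             f C.∘ g C.≈ h C.∘ i → _₁_ f D.∘ _₁_ g D.≈ _₁_ h D.∘ _₁_ i
  F-square p = D.Equiv.trans (D.Equiv.sym homomorphism)
                             (D.Equiv.trans (F-resp-≈ p) homomorphism)

  F-triangle : ∀ {A B D} {f : B C.⇒ D} {g : A C.⇒ B} {h : A C.⇒ D} →
               f C.∘ g C.≈ h → _₁_ f D.∘ _₁_ g D.≈ _₁_ h
  F-triangle p = D.Equiv.trans (D.Equiv.sym homomorphism) (F-resp-≈ p)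

open Functor public using (_₀_; _₁_)

Endofunctor : Category o ℓ e → Set (o ⊔ ℓ ⊔ e)
Endofunctor C = Functor C C

idF : {C : Category o ℓ e} → Endofunctor C
idF {C = C} = record
  { _₀_          = λ X → X
  ; _₁_          = λ f → f
  ; identity     = Equiv.refl
  ; homomorphism = Equiv.refl
  ; F-resp-≈     = λ p → p
  } where open Category C

_∘F_ : {C : Category o ℓ e} {D : Category o′ ℓ′ e′} {E : Category o″ ℓ″ e″} →
       Functor D E → Functor C D → Functor C E
_∘F_ {E = E} G F = record
  { _₀_          = λ X → G ₀ (F ₀ X)
  ; _₁_          = λ f → G ₁ (F ₁ f)
  ; identity     = Equiv.trans (G.F-resp-≈ F.identity) G.identity
  ; homomorphism = Equiv.trans (G.F-resp-≈ F.homomorphism) G.homomorphism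
  ; F-resp-≈     = λ p → G.F-resp-≈ (F.F-resp-≈ p)
  }
  where
  open Category E
  module F = Functor F
  module G = Functor G

record NaturalTransformation {C : Category o ℓ e} {D : Category o′ ℓ′ e′}
                             (F G : Functor C D) : Set (o ⊔ ℓ ⊔ ℓ′ ⊔ e′) where
  private
    module C = Category C
  open Category D
  infixl 10 _·_
  field
    _·_     : ∀ X → F ₀ X ⇒ G ₀ X
    commute : ∀ {X Y} (f : X C.⇒ Y) → _·_ Y ∘ F ₁ f ≈ G ₁ f ∘ _·_ X

open NaturalTransformation public using (_·_)

record Monad (C : Category o ℓ e) : Set (o ⊔ ℓ ⊔ e) where
  open Category C
  field
    F         : Endofunctor C
    η         : NaturalTransformation idF F
    μ         : NaturalTransformation (F ∘F F) F
    mul-assoc : ∀ X → μ · X ∘ F ₁ (μ · X) ≈ μ · X ∘ μ · (F ₀ X)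
    mul-unitˡ : ∀ X → μ · X ∘ F ₁ (η · X) ≈ id
    mul-unitʳ : ∀ X → μ · X ∘ η · (F ₀ X) ≈ id

  open Functor F public using (identity; homomorphism; F-resp-≈; F-square; F-triangle)
  module η = NaturalTransformation η
  module μ = NaturalTransformation μ

record Adjunction {C : Category o ℓ e} {D : Category o′ ℓ′ e′}
                  (L : Functor C D) (R : Functor D C)
                  : Set (o ⊔ ℓ ⊔ e ⊔ o′ ⊔ ℓ′ ⊔ e′) where
  private
    module C = Category C
    module D = Category D
  field
    unit   : NaturalTransformation idF (R ∘F L)
    counit : NaturalTransformation (L ∘F R) idF
    zig    : ∀ X → counit · (L ₀ X) D.∘ L ₁ (unit · X) D.≈ D.id
    zag    : ∀ A → R ₁ (counit · A) C.∘ unit · (R ₀ A) C.≈ C.id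

  module unit   = NaturalTransformation unit
  module counit = NaturalTransformation counit

adjunctionMonad : {C : Category o ℓ e} {D : Category o′ ℓ′ e′}
                  {L : Functor C D} {R : Functor D C} → Adjunction L R → Monad C
adjunctionMonad {C = C} {D} {L = L} {R = R} L⊣R = record
  { F         = R ∘F L
  ; η         = unit
  ; μ         = record
    { _·_     = λ X → R ₁ (counit · (L ₀ X))
    ; commute = λ f → R.F-square (counit.commute (L ₁ f))
    }
  ; mul-assoc = λ X → R.F-square (counit.commute (counit · (L ₀ X)))
  ; mul-unitˡ = λ X → Equiv.trans (R.F-triangle (zig X)) R.identity
  ; mul-unitʳ = λ X → zag (L ₀ X)
  }
  where
  open Category C
  open Adjunction L⊣R
  module R = Functor R

composeAdjunction :
  {C : Category o ℓ e} {D : Category o′ ℓ′ e′} {E : Category o″ ℓ″ e″}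
  {L : Functor C D} {R : Functor D C} {L′ : Functor D E} {R′ : Functor E D} →
  Adjunction L R → Adjunction L′ R′ → Adjunction (L′ ∘F L) (R ∘F R′)
composeAdjunction {C = C} {D} {E} {L} {R} {L′} {R′} L⊣R L′⊣R′ = record
  { unit   = record
    { _·_     = λ X → R ₁ (adj′.unit · (L ₀ X)) C.∘ adj.unit · X
    ; commute = λ f →
        C.Equiv.trans C.assoc
          (C.Equiv.trans (C.∘-resp-≈ʳ (adj.unit.commute f))
            (C.extendʳ (R.F-square (adj′.unit.commute (L ₁ f)))))
    }
  ; counit = record
    { _·_     = λ A → adj′.counit · A E.∘ L′ ₁ (adj.counit · (R′ ₀ A))
    ; commute = λ f →
        E.Equiv.trans E.assoc
          (E.Equiv.trans (E.∘-resp-≈ʳ (L′.F-square (adj.counit.commute (R′ ₁ f))))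
            (E.extendʳ (adj′.counit.commute f)))
    }
  ; zig    = λ X →
      E.Equiv.trans E.assoc
        (E.Equiv.trans
          (E.∘-resp-≈ʳ (L′.F-triangle
            (D.Equiv.trans (D.∘-resp-≈ʳ L.homomorphism)
              (D.Equiv.trans (D.extendʳ (adj.counit.commute (adj′.unit · (L ₀ X))))
                (D.Equiv.trans (D.∘-resp-≈ʳ (adj.zig X)) D.identityʳ)))))
          (adj′.zig (L ₀ X)))
  ; zag    = λ A →
      C.Equiv.trans (C.pullˡ (R.F-triangle
          (D.Equiv.trans (D.∘-resp-≈ˡ R′.homomorphism)
            (D.Equiv.trans D.assoc
              (D.Equiv.trans
                (D.∘-resp-≈ʳ (D.Equiv.sym (adj′.unit.commute (adj.counit · (R′ ₀ A)))))
                (D.cancelˡ (adj′.zag A)))))))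
        (adj.zag (R′ ₀ A))
  }
  where
  module C = Category C
  module D = Category D
  module E = Category E
  module L = Functor L
  module R = Functor R
  module L′ = Functor L′
  module R′ = Functor R′
  module adj = Adjunction L⊣R
  module adj′ = Adjunction L′⊣R′

module _ {C : Category o ℓ e} (T : Monad C) where
  open Category C
  private
    module T = Monad T

  record Algebra : Set (o ⊔ ℓ ⊔ e) where
    field
      carrier   : Obj
      structure : T.F ₀ carrier ⇒ carrier
      alg-unit  : structure ∘ T.η · carrier ≈ id
      alg-assoc : structure ∘ T.F ₁ structure ≈ structure ∘ T.μ · carrier

  record AlgebraHom (A B : Algebra) : Set (ℓ ⊔ e) where
    private
      module A = Algebra A
      module B = Algebra B
    field
      arr      : A.carrier ⇒ B.carrier
      commutes : arr ∘ A.structure ≈ B.structure ∘ T.F ₁ arr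

  open Algebra
  open AlgebraHom

  EM : Category (o ⊔ ℓ ⊔ e) (ℓ ⊔ e) e
  EM = record
    { Obj       = Algebra
    ; _⇒_       = AlgebraHom
    ; _≈_       = λ f g → arr f ≈ arr g
    ; id        = record
      { arr      = id
      ; commutes = Equiv.trans identityˡ
          (Equiv.sym (Equiv.trans (∘-resp-≈ʳ T.identity) identityʳ))
      }
    ; _∘_       = λ g f → record
      { arr      = arr g ∘ arr f
      ; commutes = Equiv.trans assoc
          (Equiv.trans (∘-resp-≈ʳ (commutes f))
            (Equiv.trans (extendʳ (commutes g))
              (∘-resp-≈ʳ (Equiv.sym T.homomorphism))))
      }
    ; assoc     = assoc
    ; identityˡ = identityˡ
    ; identityʳ = identityʳ
    ; equiv     = record
      { refl = Equiv.refl ; sym = Equiv.sym ; trans = Equiv.trans }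
    ; ∘-resp-≈  = ∘-resp-≈
    }

  Forgetful : Functor EM C
  Forgetful = record
    { _₀_          = carrier
    ; _₁_          = arr
    ; identity     = Equiv.refl
    ; homomorphism = Equiv.refl
    ; F-resp-≈     = λ p → p
    }

  Free : Functor C EM
  Free = record
    { _₀_          = λ X → record
      { carrier   = T.F ₀ X
      ; structure = T.μ · X
      ; alg-unit  = T.mul-unitʳ X
      ; alg-assoc = T.mul-assoc X
      }
    ; _₁_          = λ f → record
      { arr      = T.F ₁ f
      ; commutes = Equiv.sym (T.μ.commute f)
      }
    ; identity     = T.identity
    ; homomorphism = T.homomorphism
    ; F-resp-≈     = T.F-resp-≈
    }

  Free⊣Forgetful : Adjunction Free Forgetful
  Free⊣Forgetful = record
    { unit   = record { _·_ = λ X → T.η · X ; commute = T.η.commute }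
    ; counit = record
      { _·_     = λ A → record
        { arr      = structure A
        ; commutes = Equiv.sym (alg-assoc A)
        }
      ; commute = λ f → Equiv.sym (commutes f)
      }
    ; zig    = T.mul-unitˡ
    ; zag    = alg-unit
    }

module _ {C : Category o ℓ e} where
  open Category C

  -- Weak: compatibility of δ with the unit of T is not required.
  record IsWeakDistributiveLaw
      (T S : Monad C)
      (δ : NaturalTransformation (Monad.F T ∘F Monad.F S) (Monad.F S ∘F Monad.F T))
      : Set (o ⊔ e) where
    private
      module T = Monad T
      module S = Monad S
    field
      δ-μᵀ : ∀ X → δ · X ∘ T.μ · (S.F ₀ X) ≈
                   S.F ₁ (T.μ · X) ∘ δ · (T.F ₀ X) ∘ T.F ₁ (δ · X)
      δ-μˢ : ∀ X → δ · X ∘ T.F ₁ (S.μ · X) ≈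
                   S.μ · (T.F ₀ X) ∘ S.F ₁ (δ · X) ∘ δ · (S.F ₀ X)
      δ-ηˢ : ∀ X → δ · X ∘ T.F ₁ (S.η · X) ≈ S.η · (T.F ₀ X)

  module _ (R : Monad C) (G : Endofunctor C)
           (ρ : NaturalTransformation (Monad.F R ∘F G) (G ∘F Monad.F R)) where
    private
      module R = Monad R

    IsWeakDistributiveLawOver : Set (o ⊔ e)
    IsWeakDistributiveLawOver =
      ∀ X → ρ · X ∘ R.μ · (G ₀ X) ≈
            G ₁ (R.μ · X) ∘ ρ · (R.F ₀ X) ∘ R.F ₁ (ρ · X)

    IsStrong : Set (o ⊔ e)
    IsStrong = ∀ X → ρ · X ∘ R.η · (G ₀ X) ≈ G ₁ (R.η · X)

record WeakLifting {C : Category o ℓ e} (S T : Monad C) : Set (o ⊔ ℓ ⊔ e) where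
  open Category C
  private
    module S = Monad S
    U = Forgetful T
  field
    Ŝ : Monad (EM T)
  module Ŝ = Monad Ŝ
  field
    π   : NaturalTransformation (S.F ∘F U) (U ∘F Ŝ.F)
    ι   : NaturalTransformation (U ∘F Ŝ.F) (S.F ∘F U)
    π-ι : ∀ A → π · A ∘ ι · A ≈ id
    ι-μ : ∀ A → ι · A ∘ U ₁ (Ŝ.μ · A) ≈
                S.μ · (U ₀ A) ∘ S.F ₁ (ι · A) ∘ ι · (Ŝ.F ₀ A)
    π-μ : ∀ A → U ₁ (Ŝ.μ · A) ∘ π · (Ŝ.F ₀ A) ∘ S.F ₁ (π · A) ≈
                π · A ∘ S.μ · (U ₀ A)
    ι-η : ∀ A → ι · A ∘ U ₁ (Ŝ.η · A) ≈ S.η · (U ₀ A)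
    π-η : ∀ A → π · A ∘ S.η · (U ₀ A) ≈ U ₁ (Ŝ.η · A)
  module π = NaturalTransformation π
  module ι = NaturalTransformation ι

IsCorrespondingLifting :
  {C : Category o ℓ e} (T S : Monad C) →
  NaturalTransformation (Monad.F T ∘F Monad.F S) (Monad.F S ∘F Monad.F T) →
  WeakLifting S T → Set (o ⊔ e)
IsCorrespondingLifting {C = C} T S δ lifting =
  ∀ X → δ · X ≈ ι · (Fᵀ ₀ X) ∘ Uᵀ ₁ (εᵀ · (Ŝ.F ₀ (Fᵀ ₀ X)))
                 ∘ T.F ₁ (π · (Fᵀ ₀ X)) ∘ T.F ₁ (S.F ₁ (T.η · X))
  where
  open Category C
  open WeakLifting lifting
  module T = Monad T
  module S = Monad S
  Fᵀ = Free T
  Uᵀ = Forgetful T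
  εᵀ = Adjunction.counit (Free⊣Forgetful T)

-- If idempotents split, every weak distributive law δ has a corresponding weak
-- lifting: the splittings of the idempotents S x ∘ δ ∘ η at each algebra (X , x)
-- carry one.

module LiftingOf
    {C : Category o ℓ e} (split : IdempotentsSplit C) (T S : Monad C)
    (δ : NaturalTransformation (Monad.F T ∘F Monad.F S) (Monad.F S ∘F Monad.F T))
    (law : IsWeakDistributiveLaw T S δ) where
  open Category C
  open HomReasoning
  open IsWeakDistributiveLaw law
  private
    module T = Monad T
    module S = Monad S
    module δ = NaturalTransformation δ
    module Alg = Category (EM T)
  open Algebra
  open AlgebraHom

  ∥_∥ : Alg.Obj → Obj
  ∥ A ∥ = carrier A

  semi : ∀ A → T.F ₀ (S.F ₀ ∥ A ∥) ⇒ S.F ₀ ∥ A ∥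
  semi A = S.F ₁ (structure A) ∘ δ · ∥ A ∥

  semi-assoc : ∀ A → semi A ∘ T.μ · _ ≈ semi A ∘ T.F ₁ (semi A)
  semi-assoc A = begin
    (S.F ₁ a ∘ δ · X) ∘ T.μ · _                         ≈⟨ assoc ⟩
    S.F ₁ a ∘ δ · X ∘ T.μ · _                           ≈⟨ ∘-resp-≈ʳ (δ-μᵀ X) ⟩
    S.F ₁ a ∘ S.F ₁ (T.μ · X) ∘ δ · _ ∘ T.F ₁ (δ · X)
      ≈⟨ extendʳ (S.F-square (Equiv.sym (alg-assoc A))) ⟩
    S.F ₁ a ∘ S.F ₁ (T.F ₁ a) ∘ δ · _ ∘ T.F ₁ (δ · X)
      ≈⟨ ∘-resp-≈ʳ (extendʳ (Equiv.sym (δ.commute a))) ⟩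
    S.F ₁ a ∘ δ · X ∘ T.F ₁ (S.F ₁ a) ∘ T.F ₁ (δ · X)
      ≈⟨ ∘-resp-≈ʳ (∘-resp-≈ʳ (Equiv.sym T.homomorphism)) ⟩
    S.F ₁ a ∘ δ · X ∘ T.F ₁ (semi A)                    ≈⟨ assoc ⟨
    semi A ∘ T.F ₁ (semi A)                             ∎
    where X = carrier A
          a = structure A

  semi-nat : ∀ {A B} (h : A Alg.⇒ B) →
             S.F ₁ (arr h) ∘ semi A ≈ semi B ∘ T.F ₁ (S.F ₁ (arr h))
  semi-nat h = Equiv.trans (extendʳ (S.F-square (commutes h)))
    (Equiv.trans (∘-resp-≈ʳ (Equiv.sym (δ.commute (arr h)))) (Equiv.sym assoc))

  semi-η : ∀ A → semi A ∘ T.F ₁ (S.η · ∥ A ∥) ≈ S.η · ∥ A ∥ ∘ structure A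
  semi-η A = Equiv.trans assoc
    (Equiv.trans (∘-resp-≈ʳ (δ-ηˢ _)) (Equiv.sym (S.η.commute (structure A))))

  semi² : ∀ A → T.F ₀ (S.F ₀ (S.F ₀ ∥ A ∥)) ⇒ S.F ₀ (S.F ₀ ∥ A ∥)
  semi² A = S.F ₁ (semi A) ∘ δ · _

  semi-μ : ∀ A → semi A ∘ T.F ₁ (S.μ · ∥ A ∥) ≈ S.μ · ∥ A ∥ ∘ semi² A
  semi-μ A = begin
    (S.F ₁ a ∘ δ · X) ∘ T.F ₁ (S.μ · X)                   ≈⟨ assoc ⟩
    S.F ₁ a ∘ δ · X ∘ T.F ₁ (S.μ · X)                     ≈⟨ ∘-resp-≈ʳ (δ-μˢ X) ⟩
    S.F ₁ a ∘ S.μ · _ ∘ S.F ₁ (δ · X) ∘ δ · _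
      ≈⟨ extendʳ (Equiv.sym (S.μ.commute a)) ⟩
    S.μ · X ∘ S.F ₁ (S.F ₁ a) ∘ S.F ₁ (δ · X) ∘ δ · _
      ≈⟨ ∘-resp-≈ʳ (pullˡ (Equiv.sym S.homomorphism)) ⟩
    S.μ · X ∘ semi² A                                     ∎
    where X = carrier A
          a = structure A

  idem : ∀ A → S.F ₀ ∥ A ∥ ⇒ S.F ₀ ∥ A ∥
  idem A = semi A ∘ T.η · _

  idem-semi : ∀ A → idem A ∘ semi A ≈ semi A
  idem-semi A = begin
    (semi A ∘ T.η · _) ∘ semi A          ≈⟨ assoc ⟩
    semi A ∘ T.η · _ ∘ semi A            ≈⟨ ∘-resp-≈ʳ (T.η.commute (semi A)) ⟩
    semi A ∘ T.F ₁ (semi A) ∘ T.η · _    ≈⟨ extendʳ (Equiv.sym (semi-assoc A)) ⟩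
    semi A ∘ T.μ · _ ∘ T.η · _           ≈⟨ ∘-resp-≈ʳ (T.mul-unitʳ _) ⟩
    semi A ∘ id                          ≈⟨ identityʳ ⟩
    semi A                               ∎

  semi-idem : ∀ A → semi A ∘ T.F ₁ (idem A) ≈ semi A
  semi-idem A = begin
    semi A ∘ T.F ₁ (idem A)                     ≈⟨ ∘-resp-≈ʳ T.homomorphism ⟩
    semi A ∘ T.F ₁ (semi A) ∘ T.F ₁ (T.η · _)   ≈⟨ extendʳ (Equiv.sym (semi-assoc A)) ⟩
    semi A ∘ T.μ · _ ∘ T.F ₁ (T.η · _)          ≈⟨ ∘-resp-≈ʳ (T.mul-unitˡ _) ⟩
    semi A ∘ id                                 ≈⟨ identityʳ ⟩
    semi A                                      ∎

  idem-idem : ∀ A → idem A ∘ idem A ≈ idem A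
  idem-idem A = pullˡ (idem-semi A)

  idem-nat : ∀ {A B} (h : A Alg.⇒ B) →
             S.F ₁ (arr h) ∘ idem A ≈ idem B ∘ S.F ₁ (arr h)
  idem-nat h = Equiv.trans (extendʳ (semi-nat h))
    (Equiv.trans (∘-resp-≈ʳ (Equiv.sym (T.η.commute _))) (Equiv.sym assoc))

  idem-η : ∀ A → idem A ∘ S.η · ∥ A ∥ ≈ S.η · ∥ A ∥
  idem-η A = begin
    (semi A ∘ T.η · _) ∘ S.η · _          ≈⟨ assoc ⟩
    semi A ∘ T.η · _ ∘ S.η · _            ≈⟨ ∘-resp-≈ʳ (T.η.commute _) ⟩
    semi A ∘ T.F ₁ (S.η · _) ∘ T.η · _    ≈⟨ extendʳ (semi-η A) ⟩
    S.η · _ ∘ structure A ∘ T.η · _       ≈⟨ ∘-resp-≈ʳ (alg-unit A) ⟩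
    S.η · _ ∘ id                          ≈⟨ identityʳ ⟩
    S.η · _                               ∎

  opaque
    splitting : ∀ A → Splitting C (idem A)
    splitting A = split (idem A) (idem-idem A)

  module _ (A : Alg.Obj) where
    open Splitting (splitting A) public
      renaming (retract to r; section to s; retracts to r-s; splits to s-r)

  r-idem : ∀ A → r A ∘ idem A ≈ r A
  r-idem A = Equiv.trans (∘-resp-≈ʳ (Equiv.sym (s-r A))) (cancelˡ (r-s A))

  idem-s : ∀ A → idem A ∘ s A ≈ s A
  idem-s A = Equiv.trans (∘-resp-≈ˡ (Equiv.sym (s-r A)))
    (Equiv.trans assoc (Equiv.trans (∘-resp-≈ʳ (r-s A)) identityʳ))

  s-mono : ∀ A {X} {f g : X ⇒ obj A} → s A ∘ f ≈ s A ∘ g → f ≈ g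
  s-mono A {f = f} {g} p = begin
    f              ≈⟨ cancelˡ (r-s A) ⟨
    r A ∘ s A ∘ f  ≈⟨ ∘-resp-≈ʳ p ⟩
    r A ∘ s A ∘ g  ≈⟨ cancelˡ (r-s A) ⟩
    g              ∎

  s-r-semi : ∀ A {X} {f : X ⇒ _} → s A ∘ r A ∘ semi A ∘ f ≈ semi A ∘ f
  s-r-semi A = Equiv.trans (pullˡ (s-r A)) (pullˡ (idem-semi A))

  semi-s-r : ∀ A {X} {f : X ⇒ _} → semi A ∘ T.F ₁ (s A) ∘ T.F ₁ (r A) ∘ f ≈ semi A ∘ f
  semi-s-r A = Equiv.trans (∘-resp-≈ʳ (pullˡ (T.F-triangle (s-r A)))) (pullˡ (semi-idem A))

  ŝ-structure : ∀ A → T.F ₀ (obj A) ⇒ obj A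
  ŝ-structure A = r A ∘ semi A ∘ T.F ₁ (s A)

  opaque
    ŝ-unit : ∀ A → ŝ-structure A ∘ T.η · (obj A) ≈ id
    ŝ-unit A = begin
      (r A ∘ semi A ∘ T.F ₁ (s A)) ∘ T.η · (obj A)   ≈⟨ Equiv.trans assoc (∘-resp-≈ʳ assoc) ⟩
      r A ∘ semi A ∘ T.F ₁ (s A) ∘ T.η · (obj A)
        ≈⟨ ∘-resp-≈ʳ (∘-resp-≈ʳ (Equiv.sym (T.η.commute (s A)))) ⟩
      r A ∘ semi A ∘ T.η · _ ∘ s A                 ≈⟨ ∘-resp-≈ʳ assoc ⟨
      r A ∘ idem A ∘ s A                           ≈⟨ ∘-resp-≈ʳ (idem-s A) ⟩
      r A ∘ s A                                    ≈⟨ r-s A ⟩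
      id                                           ∎

    ŝ-assoc : ∀ A → ŝ-structure A ∘ T.F ₁ (ŝ-structure A) ≈ ŝ-structure A ∘ T.μ · (obj A)
    ŝ-assoc A = begin
      ŝ-structure A ∘ T.F ₁ (ŝ-structure A)
        ≈⟨ Equiv.trans assoc (∘-resp-≈ʳ assoc) ⟩
      r A ∘ semi A ∘ T.F ₁ (s A) ∘ T.F ₁ (ŝ-structure A)
        ≈⟨ ∘-resp-≈ʳ (∘-resp-≈ʳ (T.F-triangle (s-r-semi A))) ⟩
      r A ∘ semi A ∘ T.F ₁ (semi A ∘ T.F ₁ (s A))
        ≈⟨ ∘-resp-≈ʳ (∘-resp-≈ʳ T.homomorphism) ⟩
      r A ∘ semi A ∘ T.F ₁ (semi A) ∘ T.F ₁ (T.F ₁ (s A))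
        ≈⟨ ∘-resp-≈ʳ (extendʳ (Equiv.sym (semi-assoc A))) ⟩
      r A ∘ semi A ∘ T.μ · _ ∘ T.F ₁ (T.F ₁ (s A))
        ≈⟨ ∘-resp-≈ʳ (∘-resp-≈ʳ (T.μ.commute (s A))) ⟩
      r A ∘ semi A ∘ T.F ₁ (s A) ∘ T.μ · (obj A)
        ≈⟨ Equiv.trans assoc (∘-resp-≈ʳ assoc) ⟨
      ŝ-structure A ∘ T.μ · (obj A) ∎

  Ŝ₀ : Alg.Obj → Alg.Obj
  Ŝ₀ A = record
    { carrier   = obj A
    ; structure = ŝ-structure A
    ; alg-unit  = ŝ-unit A
    ; alg-assoc = ŝ-assoc A
    }

  r-hom : ∀ A → r A ∘ semi A ≈ structure (Ŝ₀ A) ∘ T.F ₁ (r A)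
  r-hom A = Equiv.sym (Equiv.trans (Equiv.trans assoc (∘-resp-≈ʳ assoc))
    (∘-resp-≈ʳ (Equiv.trans (∘-resp-≈ʳ (T.F-triangle (s-r A))) (semi-idem A))))

  s-hom : ∀ A → s A ∘ structure (Ŝ₀ A) ≈ semi A ∘ T.F ₁ (s A)
  s-hom A = s-r-semi A

  opaque
    hom-from-s : ∀ A B (f : ∥ A ∥ ⇒ obj B) →
                 (s B ∘ f) ∘ structure A ≈ semi B ∘ T.F ₁ (s B ∘ f) →
                 f ∘ structure A ≈ ŝ-structure B ∘ T.F ₁ f
    hom-from-s A B f p = s-mono B (begin
      s B ∘ f ∘ structure A             ≈⟨ assoc ⟨
      (s B ∘ f) ∘ structure A           ≈⟨ p ⟩
      semi B ∘ T.F ₁ (s B ∘ f)          ≈⟨ ∘-resp-≈ʳ T.homomorphism ⟩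
      semi B ∘ T.F ₁ (s B) ∘ T.F ₁ f    ≈⟨ extendʳ (Equiv.sym (s-hom B)) ⟩
      s B ∘ ŝ-structure B ∘ T.F ₁ f     ∎)

  hom-to-Ŝ₀ : ∀ A B (f : ∥ A ∥ ⇒ obj B) →
              (s B ∘ f) ∘ structure A ≈ semi B ∘ T.F ₁ (s B ∘ f) → A Alg.⇒ Ŝ₀ B
  hom-to-Ŝ₀ A B f p = record { arr = f ; commutes = hom-from-s A B f p }

  ŝ₁ : ∀ {A B} → A Alg.⇒ B → obj A ⇒ obj B
  ŝ₁ {A} {B} h = r B ∘ S.F ₁ (arr h) ∘ s A

  s-ŝ₁ : ∀ {A B} (h : A Alg.⇒ B) → s B ∘ ŝ₁ h ≈ S.F ₁ (arr h) ∘ s A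
  s-ŝ₁ {A} {B} h = begin
    s B ∘ r B ∘ S.F ₁ (arr h) ∘ s A    ≈⟨ pullˡ (s-r B) ⟩
    idem B ∘ S.F ₁ (arr h) ∘ s A       ≈⟨ extendʳ (Equiv.sym (idem-nat h)) ⟩
    S.F ₁ (arr h) ∘ idem A ∘ s A       ≈⟨ ∘-resp-≈ʳ (idem-s A) ⟩
    S.F ₁ (arr h) ∘ s A                ∎

  r-nat : ∀ {A B} (h : A Alg.⇒ B) → r B ∘ S.F ₁ (arr h) ≈ ŝ₁ h ∘ r A
  r-nat {A} {B} h = Equiv.sym (begin
    (r B ∘ S.F ₁ (arr h) ∘ s A) ∘ r A    ≈⟨ Equiv.trans assoc (∘-resp-≈ʳ assoc) ⟩
    r B ∘ S.F ₁ (arr h) ∘ s A ∘ r A      ≈⟨ ∘-resp-≈ʳ (∘-resp-≈ʳ (s-r A)) ⟩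
    r B ∘ S.F ₁ (arr h) ∘ idem A         ≈⟨ ∘-resp-≈ʳ (idem-nat h) ⟩
    r B ∘ idem B ∘ S.F ₁ (arr h)         ≈⟨ pullˡ (r-idem B) ⟩
    r B ∘ S.F ₁ (arr h)                  ∎)

  Ŝ₁ : ∀ {A B} → A Alg.⇒ B → Ŝ₀ A Alg.⇒ Ŝ₀ B
  Ŝ₁ {A} {B} h = hom-to-Ŝ₀ (Ŝ₀ A) B (ŝ₁ h) (begin
    (s B ∘ ŝ₁ h) ∘ structure (Ŝ₀ A)           ≈⟨ pushˡ (s-ŝ₁ h) ⟩
    S.F ₁ (arr h) ∘ s A ∘ structure (Ŝ₀ A)    ≈⟨ ∘-resp-≈ʳ (s-hom A) ⟩
    S.F ₁ (arr h) ∘ semi A ∘ T.F ₁ (s A)      ≈⟨ extendʳ (semi-nat h) ⟩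
    semi B ∘ T.F ₁ (S.F ₁ (arr h)) ∘ T.F ₁ (s A)
      ≈⟨ ∘-resp-≈ʳ (T.F-triangle (Equiv.sym (s-ŝ₁ h))) ⟩
    semi B ∘ T.F ₁ (s B ∘ ŝ₁ h)               ∎)

  ŝ₁-id : ∀ {A} → ŝ₁ (Alg.id {A}) ≈ id
  ŝ₁-id {A} = Equiv.trans
    (∘-resp-≈ʳ (Equiv.trans (∘-resp-≈ˡ S.identity) identityˡ)) (r-s A)

  ŝ₁-∘ : ∀ {A B D} {f : A Alg.⇒ B} {g : B Alg.⇒ D} → ŝ₁ (g Alg.∘ f) ≈ ŝ₁ g ∘ ŝ₁ f
  ŝ₁-∘ {A} {B} {D} {f} {g} = s-mono D (begin
    s D ∘ ŝ₁ (g Alg.∘ f)                 ≈⟨ s-ŝ₁ (g Alg.∘ f) ⟩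
    S.F ₁ (arr g ∘ arr f) ∘ s A          ≈⟨ pushˡ S.homomorphism ⟩
    S.F ₁ (arr g) ∘ S.F ₁ (arr f) ∘ s A  ≈⟨ ∘-resp-≈ʳ (s-ŝ₁ f) ⟨
    S.F ₁ (arr g) ∘ s B ∘ ŝ₁ f           ≈⟨ extendʳ (Equiv.sym (s-ŝ₁ g)) ⟩
    s D ∘ ŝ₁ g ∘ ŝ₁ f                    ∎)

  Ŝ-functor : Endofunctor (EM T)
  Ŝ-functor = record
    { _₀_          = Ŝ₀
    ; _₁_          = Ŝ₁
    ; identity     = λ {A} → ŝ₁-id {A}
    ; homomorphism = λ {A} {B} {D} {f} {g} → ŝ₁-∘ {f = f} {g}
    ; F-resp-≈     = λ p → ∘-resp-≈ʳ (∘-resp-≈ˡ (S.F-resp-≈ p))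
    }

  η̂ : ∀ A → ∥ A ∥ ⇒ obj A
  η̂ A = r A ∘ S.η · _

  s-η̂ : ∀ A → s A ∘ η̂ A ≈ S.η · _
  s-η̂ A = Equiv.trans (pullˡ (s-r A)) (idem-η A)

  s² : ∀ A → obj (Ŝ₀ A) ⇒ S.F ₀ (S.F ₀ ∥ A ∥)
  s² A = S.F ₁ (s A) ∘ s (Ŝ₀ A)

  μ̂ : ∀ A → obj (Ŝ₀ A) ⇒ obj A
  μ̂ A = r A ∘ S.μ · _ ∘ s² A

  semi-Ŝ₀ : ∀ A → semi (Ŝ₀ A) ≈ S.F ₁ (r A) ∘ semi² A ∘ T.F ₁ (S.F ₁ (s A))
  semi-Ŝ₀ A = begin
    S.F ₁ (r A ∘ semi A ∘ T.F ₁ (s A)) ∘ δ · _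
      ≈⟨ pushˡ S.homomorphism ⟩
    S.F ₁ (r A) ∘ S.F ₁ (semi A ∘ T.F ₁ (s A)) ∘ δ · _
      ≈⟨ ∘-resp-≈ʳ (pushˡ S.homomorphism) ⟩
    S.F ₁ (r A) ∘ S.F ₁ (semi A) ∘ S.F ₁ (T.F ₁ (s A)) ∘ δ · _
      ≈⟨ ∘-resp-≈ʳ (∘-resp-≈ʳ (Equiv.sym (δ.commute (s A)))) ⟩
    S.F ₁ (r A) ∘ S.F ₁ (semi A) ∘ δ · _ ∘ T.F ₁ (S.F ₁ (s A))
      ≈⟨ ∘-resp-≈ʳ assoc ⟨
    S.F ₁ (r A) ∘ semi² A ∘ T.F ₁ (S.F ₁ (s A)) ∎

  Ss-semi : ∀ A → S.F ₁ (s A) ∘ semi (Ŝ₀ A) ≈ semi² A ∘ T.F ₁ (S.F ₁ (s A))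
  Ss-semi A = begin
    S.F ₁ (s A) ∘ semi (Ŝ₀ A)
      ≈⟨ ∘-resp-≈ʳ (semi-Ŝ₀ A) ⟩
    S.F ₁ (s A) ∘ S.F ₁ (r A) ∘ semi² A ∘ T.F ₁ (S.F ₁ (s A))
      ≈⟨ pullˡ (S.F-triangle (s-r A)) ⟩
    S.F ₁ (idem A) ∘ (S.F ₁ (semi A) ∘ δ · _) ∘ T.F ₁ (S.F ₁ (s A))
      ≈⟨ pullˡ (pullˡ (S.F-triangle (idem-semi A))) ⟩
    semi² A ∘ T.F ₁ (S.F ₁ (s A)) ∎

  s²-semi² : ∀ A → s² A ≈ semi² A ∘ T.η · _ ∘ s² A
  s²-semi² A = begin
    S.F ₁ (s A) ∘ s (Ŝ₀ A)                              ≈⟨ ∘-resp-≈ʳ (idem-s (Ŝ₀ A)) ⟨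
    S.F ₁ (s A) ∘ (semi (Ŝ₀ A) ∘ T.η · _) ∘ s (Ŝ₀ A)    ≈⟨ ∘-resp-≈ʳ assoc ⟩
    S.F ₁ (s A) ∘ semi (Ŝ₀ A) ∘ T.η · _ ∘ s (Ŝ₀ A)      ≈⟨ extendʳ (Ss-semi A) ⟩
    semi² A ∘ T.F ₁ (S.F ₁ (s A)) ∘ T.η · _ ∘ s (Ŝ₀ A)
      ≈⟨ ∘-resp-≈ʳ (extendʳ (Equiv.sym (T.η.commute _))) ⟩
    semi² A ∘ T.η · _ ∘ s² A                            ∎

  idem-μ : ∀ A → idem A ∘ S.μ · _ ≈ S.μ · _ ∘ semi² A ∘ T.η · _
  idem-μ A = begin
    (semi A ∘ T.η · _) ∘ S.μ · _          ≈⟨ assoc ⟩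
    semi A ∘ T.η · _ ∘ S.μ · _            ≈⟨ ∘-resp-≈ʳ (T.η.commute _) ⟩
    semi A ∘ T.F ₁ (S.μ · _) ∘ T.η · _    ≈⟨ extendʳ (semi-μ A) ⟩
    S.μ · _ ∘ semi² A ∘ T.η · _           ∎

  s-μ̂ : ∀ A → s A ∘ μ̂ A ≈ S.μ · _ ∘ s² A
  s-μ̂ A = begin
    s A ∘ r A ∘ S.μ · _ ∘ s² A              ≈⟨ pullˡ (s-r A) ⟩
    idem A ∘ S.μ · _ ∘ s² A                 ≈⟨ pullˡ (idem-μ A) ⟩
    (S.μ · _ ∘ semi² A ∘ T.η · _) ∘ s² A    ≈⟨ Equiv.trans assoc (∘-resp-≈ʳ assoc) ⟩
    S.μ · _ ∘ semi² A ∘ T.η · _ ∘ s² A      ≈⟨ ∘-resp-≈ʳ (s²-semi² A) ⟨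
    S.μ · _ ∘ s² A                          ∎

  semi²-idem : ∀ A → semi² A ∘ T.F ₁ (S.F ₁ (idem A)) ≈ semi² A
  semi²-idem A = begin
    (S.F ₁ (semi A) ∘ δ · _) ∘ T.F ₁ (S.F ₁ (idem A))    ≈⟨ assoc ⟩
    S.F ₁ (semi A) ∘ δ · _ ∘ T.F ₁ (S.F ₁ (idem A))      ≈⟨ ∘-resp-≈ʳ (δ.commute _) ⟩
    S.F ₁ (semi A) ∘ S.F ₁ (T.F ₁ (idem A)) ∘ δ · _
      ≈⟨ pullˡ (S.F-triangle (semi-idem A)) ⟩
    S.F ₁ (semi A) ∘ δ · _                               ∎

  Ss-idem-Sr : ∀ A → S.F ₁ (s A) ∘ idem (Ŝ₀ A) ∘ S.F ₁ (r A) ≈ semi² A ∘ T.η · _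
  Ss-idem-Sr A = begin
    S.F ₁ (s A) ∘ (semi (Ŝ₀ A) ∘ T.η · _) ∘ S.F ₁ (r A)     ≈⟨ ∘-resp-≈ʳ assoc ⟩
    S.F ₁ (s A) ∘ semi (Ŝ₀ A) ∘ T.η · _ ∘ S.F ₁ (r A)       ≈⟨ extendʳ (Ss-semi A) ⟩
    semi² A ∘ T.F ₁ (S.F ₁ (s A)) ∘ T.η · _ ∘ S.F ₁ (r A)
      ≈⟨ ∘-resp-≈ʳ (∘-resp-≈ʳ (T.η.commute _)) ⟩
    semi² A ∘ T.F ₁ (S.F ₁ (s A)) ∘ T.F ₁ (S.F ₁ (r A)) ∘ T.η · _
      ≈⟨ ∘-resp-≈ʳ (pullˡ (T.F-triangle (S.F-triangle (s-r A)))) ⟩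
    semi² A ∘ T.F ₁ (S.F ₁ (idem A)) ∘ T.η · _              ≈⟨ pullˡ (semi²-idem A) ⟩
    semi² A ∘ T.η · _                                       ∎

  μ̂-r : ∀ A → μ̂ A ∘ r (Ŝ₀ A) ∘ S.F ₁ (r A) ≈ r A ∘ S.μ · _
  μ̂-r A = begin
    (r A ∘ S.μ · _ ∘ S.F ₁ (s A) ∘ s (Ŝ₀ A)) ∘ r (Ŝ₀ A) ∘ S.F ₁ (r A)
      ≈⟨ Equiv.trans assoc (∘-resp-≈ʳ (Equiv.trans assoc (∘-resp-≈ʳ assoc))) ⟩
    r A ∘ S.μ · _ ∘ S.F ₁ (s A) ∘ s (Ŝ₀ A) ∘ r (Ŝ₀ A) ∘ S.F ₁ (r A)
      ≈⟨ ∘-resp-≈ʳ (∘-resp-≈ʳ (∘-resp-≈ʳ (pullˡ (s-r (Ŝ₀ A))))) ⟩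
    r A ∘ S.μ · _ ∘ S.F ₁ (s A) ∘ idem (Ŝ₀ A) ∘ S.F ₁ (r A)
      ≈⟨ ∘-resp-≈ʳ (∘-resp-≈ʳ (Ss-idem-Sr A)) ⟩
    r A ∘ S.μ · _ ∘ semi² A ∘ T.η · _
      ≈⟨ ∘-resp-≈ʳ (idem-μ A) ⟨
    r A ∘ idem A ∘ S.μ · _
      ≈⟨ pullˡ (r-idem A) ⟩
    r A ∘ S.μ · _ ∎

  η̂-hom : ∀ A → A Alg.⇒ Ŝ₀ A
  η̂-hom A = hom-to-Ŝ₀ A A (η̂ A) (begin
    (s A ∘ η̂ A) ∘ structure A      ≈⟨ ∘-resp-≈ˡ (s-η̂ A) ⟩
    S.η · _ ∘ structure A          ≈⟨ semi-η A ⟨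
    semi A ∘ T.F ₁ (S.η · _)       ≈⟨ ∘-resp-≈ʳ (T.F-resp-≈ (s-η̂ A)) ⟨
    semi A ∘ T.F ₁ (s A ∘ η̂ A)     ∎)

  s²-hom : ∀ A → s² A ∘ structure (Ŝ₀ (Ŝ₀ A)) ≈ semi² A ∘ T.F ₁ (s² A)
  s²-hom A = begin
    (S.F ₁ (s A) ∘ s (Ŝ₀ A)) ∘ structure (Ŝ₀ (Ŝ₀ A))      ≈⟨ assoc ⟩
    S.F ₁ (s A) ∘ s (Ŝ₀ A) ∘ structure (Ŝ₀ (Ŝ₀ A))        ≈⟨ ∘-resp-≈ʳ (s-hom (Ŝ₀ A)) ⟩
    S.F ₁ (s A) ∘ semi (Ŝ₀ A) ∘ T.F ₁ (s (Ŝ₀ A))          ≈⟨ extendʳ (Ss-semi A) ⟩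
    semi² A ∘ T.F ₁ (S.F ₁ (s A)) ∘ T.F ₁ (s (Ŝ₀ A))
      ≈⟨ ∘-resp-≈ʳ (Equiv.sym T.homomorphism) ⟩
    semi² A ∘ T.F ₁ (s² A)                                ∎

  μ̂-hom : ∀ A → Ŝ₀ (Ŝ₀ A) Alg.⇒ Ŝ₀ A
  μ̂-hom A = hom-to-Ŝ₀ (Ŝ₀ (Ŝ₀ A)) A (μ̂ A) (begin
    (s A ∘ μ̂ A) ∘ structure (Ŝ₀ (Ŝ₀ A))        ≈⟨ pushˡ (s-μ̂ A) ⟩
    S.μ · _ ∘ s² A ∘ structure (Ŝ₀ (Ŝ₀ A))     ≈⟨ ∘-resp-≈ʳ (s²-hom A) ⟩
    S.μ · _ ∘ semi² A ∘ T.F ₁ (s² A)           ≈⟨ extendʳ (Equiv.sym (semi-μ A)) ⟩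
    semi A ∘ T.F ₁ (S.μ · _) ∘ T.F ₁ (s² A)
      ≈⟨ ∘-resp-≈ʳ (T.F-triangle (Equiv.sym (s-μ̂ A))) ⟩
    semi A ∘ T.F ₁ (s A ∘ μ̂ A)                 ∎)

  s²-nat : ∀ {A B} (h : A Alg.⇒ B) →
           s² B ∘ ŝ₁ (Ŝ₁ h) ≈ S.F ₁ (S.F ₁ (arr h)) ∘ s² A
  s²-nat {A} {B} h = begin
    (S.F ₁ (s B) ∘ s (Ŝ₀ B)) ∘ ŝ₁ (Ŝ₁ h)              ≈⟨ assoc ⟩
    S.F ₁ (s B) ∘ s (Ŝ₀ B) ∘ ŝ₁ (Ŝ₁ h)                ≈⟨ ∘-resp-≈ʳ (s-ŝ₁ (Ŝ₁ h)) ⟩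
    S.F ₁ (s B) ∘ S.F ₁ (ŝ₁ h) ∘ s (Ŝ₀ A)             ≈⟨ extendʳ (S.F-square (s-ŝ₁ h)) ⟩
    S.F ₁ (S.F ₁ (arr h)) ∘ S.F ₁ (s A) ∘ s (Ŝ₀ A)    ∎

  η̂-nat : ∀ {A B} (h : A Alg.⇒ B) → η̂ B ∘ arr h ≈ ŝ₁ h ∘ η̂ A
  η̂-nat {A} {B} h = s-mono B (begin
    s B ∘ η̂ B ∘ arr h           ≈⟨ pullˡ (s-η̂ B) ⟩
    S.η · _ ∘ arr h             ≈⟨ S.η.commute (arr h) ⟩
    S.F ₁ (arr h) ∘ S.η · _     ≈⟨ ∘-resp-≈ʳ (s-η̂ A) ⟨
    S.F ₁ (arr h) ∘ s A ∘ η̂ A   ≈⟨ extendʳ (Equiv.sym (s-ŝ₁ h)) ⟩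
    s B ∘ ŝ₁ h ∘ η̂ A            ∎)

  μ̂-nat : ∀ {A B} (h : A Alg.⇒ B) → μ̂ B ∘ ŝ₁ (Ŝ₁ h) ≈ ŝ₁ h ∘ μ̂ A
  μ̂-nat {A} {B} h = s-mono B (begin
    s B ∘ μ̂ B ∘ ŝ₁ (Ŝ₁ h)                      ≈⟨ extendʳ (s-μ̂ B) ⟩
    S.μ · _ ∘ s² B ∘ ŝ₁ (Ŝ₁ h)                 ≈⟨ ∘-resp-≈ʳ (s²-nat h) ⟩
    S.μ · _ ∘ S.F ₁ (S.F ₁ (arr h)) ∘ s² A     ≈⟨ extendʳ (S.μ.commute (arr h)) ⟩
    S.F ₁ (arr h) ∘ S.μ · _ ∘ s² A             ≈⟨ ∘-resp-≈ʳ (s-μ̂ A) ⟨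
    S.F ₁ (arr h) ∘ s A ∘ μ̂ A                  ≈⟨ extendʳ (Equiv.sym (s-ŝ₁ h)) ⟩
    s B ∘ ŝ₁ h ∘ μ̂ A                           ∎)

  μ̂-assoc : ∀ A → μ̂ A ∘ ŝ₁ (μ̂-hom A) ≈ μ̂ A ∘ μ̂ (Ŝ₀ A)
  μ̂-assoc A = s-mono A (begin
    s A ∘ μ̂ A ∘ ŝ₁ (μ̂-hom A)
      ≈⟨ extendʳ (s-μ̂ A) ⟩
    S.μ · X ∘ (S.F ₁ (s A) ∘ s A′) ∘ ŝ₁ (μ̂-hom A)
      ≈⟨ ∘-resp-≈ʳ assoc ⟩
    S.μ · X ∘ S.F ₁ (s A) ∘ s A′ ∘ ŝ₁ (μ̂-hom A)
      ≈⟨ ∘-resp-≈ʳ (∘-resp-≈ʳ (s-ŝ₁ (μ̂-hom A))) ⟩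
    S.μ · X ∘ S.F ₁ (s A) ∘ S.F ₁ (μ̂ A) ∘ s (Ŝ₀ A′)
      ≈⟨ ∘-resp-≈ʳ (extendʳ (S.F-square (s-μ̂ A))) ⟩
    S.μ · X ∘ S.F ₁ (S.μ · X) ∘ S.F ₁ (s² A) ∘ s (Ŝ₀ A′)
      ≈⟨ extendʳ (S.mul-assoc X) ⟩
    S.μ · X ∘ S.μ · (S.F ₀ X) ∘ S.F ₁ (s² A) ∘ s (Ŝ₀ A′)
      ≈⟨ ∘-resp-≈ʳ (∘-resp-≈ʳ (pushˡ S.homomorphism)) ⟩
    S.μ · X ∘ S.μ · (S.F ₀ X) ∘ S.F ₁ (S.F ₁ (s A)) ∘ s² A′
      ≈⟨ ∘-resp-≈ʳ (extendʳ (S.μ.commute (s A))) ⟩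
    S.μ · X ∘ S.F ₁ (s A) ∘ S.μ · (obj A) ∘ s² A′
      ≈⟨ ∘-resp-≈ʳ (∘-resp-≈ʳ (s-μ̂ A′)) ⟨
    S.μ · X ∘ S.F ₁ (s A) ∘ s A′ ∘ μ̂ A′
      ≈⟨ ∘-resp-≈ʳ assoc ⟨
    S.μ · X ∘ s² A ∘ μ̂ A′
      ≈⟨ extendʳ (Equiv.sym (s-μ̂ A)) ⟩
    s A ∘ μ̂ A ∘ μ̂ A′ ∎)
    where X = carrier A
          A′ = Ŝ₀ A

  μ̂-unitˡ : ∀ A → μ̂ A ∘ ŝ₁ (η̂-hom A) ≈ id
  μ̂-unitˡ A = s-mono A (begin
    s A ∘ μ̂ A ∘ ŝ₁ (η̂-hom A)                             ≈⟨ extendʳ (s-μ̂ A) ⟩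
    S.μ · X ∘ (S.F ₁ (s A) ∘ s A′) ∘ ŝ₁ (η̂-hom A)        ≈⟨ ∘-resp-≈ʳ assoc ⟩
    S.μ · X ∘ S.F ₁ (s A) ∘ s A′ ∘ ŝ₁ (η̂-hom A)
      ≈⟨ ∘-resp-≈ʳ (∘-resp-≈ʳ (s-ŝ₁ (η̂-hom A))) ⟩
    S.μ · X ∘ S.F ₁ (s A) ∘ S.F ₁ (η̂ A) ∘ s A
      ≈⟨ ∘-resp-≈ʳ (pullˡ (S.F-triangle (s-η̂ A))) ⟩
    S.μ · X ∘ S.F ₁ (S.η · X) ∘ s A                      ≈⟨ cancelˡ (S.mul-unitˡ X) ⟩
    s A                                                  ≈⟨ identityʳ ⟨
    s A ∘ id                                             ∎)
    where X = carrier A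
          A′ = Ŝ₀ A

  μ̂-unitʳ : ∀ A → μ̂ A ∘ η̂ (Ŝ₀ A) ≈ id
  μ̂-unitʳ A = s-mono A (begin
    s A ∘ μ̂ A ∘ η̂ A′                          ≈⟨ extendʳ (s-μ̂ A) ⟩
    S.μ · X ∘ (S.F ₁ (s A) ∘ s A′) ∘ η̂ A′     ≈⟨ ∘-resp-≈ʳ assoc ⟩
    S.μ · X ∘ S.F ₁ (s A) ∘ s A′ ∘ η̂ A′       ≈⟨ ∘-resp-≈ʳ (∘-resp-≈ʳ (s-η̂ A′)) ⟩
    S.μ · X ∘ S.F ₁ (s A) ∘ S.η · (obj A)     ≈⟨ ∘-resp-≈ʳ (S.η.commute (s A)) ⟨
    S.μ · X ∘ S.η · (S.F ₀ X) ∘ s A           ≈⟨ cancelˡ (S.mul-unitʳ X) ⟩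
    s A                                       ≈⟨ identityʳ ⟨
    s A ∘ id                                  ∎)
    where X = carrier A
          A′ = Ŝ₀ A

  Ŝ-monad : Monad (EM T)
  Ŝ-monad = record
    { F         = Ŝ-functor
    ; η         = record { _·_ = η̂-hom ; commute = η̂-nat }
    ; μ         = record { _·_ = μ̂-hom ; commute = μ̂-nat }
    ; mul-assoc = μ̂-assoc
    ; mul-unitˡ = μ̂-unitˡ
    ; mul-unitʳ = μ̂-unitʳ
    }

  weakLifting : WeakLifting S T
  weakLifting = record
    { Ŝ   = Ŝ-monad
    ; π   = record { _·_ = r ; commute = r-nat }
    ; ι   = record { _·_ = s ; commute = s-ŝ₁ }
    ; π-ι = r-s
    ; ι-μ = s-μ̂
    ; π-μ = μ̂-r
    ; ι-η = s-η̂
    ; π-η = λ A → Equiv.refl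
    }

  isCorrespondingLifting : IsCorrespondingLifting T S δ weakLifting
  isCorrespondingLifting X = Equiv.sym (begin
    s A ∘ structure (Ŝ₀ A) ∘ T.F ₁ (r A) ∘ T.F ₁ (S.F ₁ (T.η · X))
      ≈⟨ extendʳ (s-hom A) ⟩
    semi A ∘ T.F ₁ (s A) ∘ T.F ₁ (r A) ∘ T.F ₁ (S.F ₁ (T.η · X))
      ≈⟨ semi-s-r A ⟩
    (S.F ₁ (T.μ · X) ∘ δ · _) ∘ T.F ₁ (S.F ₁ (T.η · X))
      ≈⟨ assoc ⟩
    S.F ₁ (T.μ · X) ∘ δ · _ ∘ T.F ₁ (S.F ₁ (T.η · X))
      ≈⟨ ∘-resp-≈ʳ (δ.commute (T.η · X)) ⟩
    S.F ₁ (T.μ · X) ∘ S.F ₁ (T.F ₁ (T.η · X)) ∘ δ · X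
      ≈⟨ cancelˡ (Equiv.trans (S.F-triangle (T.mul-unitˡ X)) S.identity) ⟩
    δ · X ∎)
    where A = Free T ₀ X

module _ {C : Category o ℓ e} {T S : Monad C} (lifting : WeakLifting S T) where
  open Category C
  open WeakLifting lifting
  private
    module T = Monad T
    module S = Monad S

  compositeMonad : Monad C
  compositeMonad =
    adjunctionMonad (composeAdjunction (Free⊣Forgetful T) (Free⊣Forgetful Ŝ))

  [ST] : Endofunctor C
  [ST] = Monad.F compositeMonad

  private
    U = Forgetful T
    F = Free T
    εᵀ = Adjunction.counit (Free⊣Forgetful T)

    unit-formula : ∀ X → Monad.η compositeMonad · X ≈ U ₁ (Ŝ.η · (F ₀ X)) ∘ T.η · X
    unit-formula X = Equiv.refl

    multiplication-formula : ∀ X → Monad.μ compositeMonad · X ≈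
      U ₁ (Ŝ.μ · (F ₀ X)) ∘ U ₁ (Ŝ.F ₁ (εᵀ · (Ŝ.F ₀ (F ₀ X))))
    multiplication-formula X = Equiv.refl

  ι* : NaturalTransformation [ST] (S.F ∘F T.F)
  ι* = record
    { _·_     = λ X → ι · (Free T ₀ X)
    ; commute = λ f → ι.commute (Free T ₁ f)
    }

  π* : NaturalTransformation (S.F ∘F T.F) [ST]
  π* = record
    { _·_     = λ X → π · (Free T ₀ X)
    ; commute = λ f → π.commute (Free T ₁ f)
    }

  module _ {G : Endofunctor C}
           (σ : NaturalTransformation (T.F ∘F G) (G ∘F T.F))
           (τ : NaturalTransformation (S.F ∘F G) (G ∘F S.F)) where
    private
      module G  = Functor G
      module σ  = NaturalTransformation σ
      module τ  = NaturalTransformation τ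
      module ι* = NaturalTransformation ι*
      module π* = NaturalTransformation π*

    compositeLaw : NaturalTransformation ([ST] ∘F G) (G ∘F [ST])
    compositeLaw = record
      { _·_     = λ X → G ₁ (π* · X) ∘ τ · (T.F ₀ X) ∘ S.F ₁ (σ · X) ∘ ι* · (G ₀ X)
      ; commute = λ {X} {Y} f →
          let open HomReasoning in begin
          (G ₁ (π* · Y) ∘ τ · (T.F ₀ Y) ∘ S.F ₁ (σ · Y) ∘ ι* · (G ₀ Y)) ∘ [ST] ₁ (G ₁ f)
            ≈⟨ Equiv.trans assoc (∘-resp-≈ʳ (Equiv.trans assoc (∘-resp-≈ʳ assoc))) ⟩
          G ₁ (π* · Y) ∘ τ · (T.F ₀ Y) ∘ S.F ₁ (σ · Y) ∘ ι* · (G ₀ Y) ∘ [ST] ₁ (G ₁ f)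
            ≈⟨ ∘-resp-≈ʳ (∘-resp-≈ʳ (∘-resp-≈ʳ (ι*.commute (G ₁ f)))) ⟩
          G ₁ (π* · Y) ∘ τ · (T.F ₀ Y) ∘ S.F ₁ (σ · Y) ∘ S.F ₁ (T.F ₁ (G ₁ f)) ∘ ι* · (G ₀ X)
            ≈⟨ ∘-resp-≈ʳ (∘-resp-≈ʳ (extendʳ (S.F-square (σ.commute f)))) ⟩
          G ₁ (π* · Y) ∘ τ · (T.F ₀ Y) ∘ S.F ₁ (G ₁ (T.F ₁ f)) ∘ S.F ₁ (σ · X) ∘ ι* · (G ₀ X)
            ≈⟨ ∘-resp-≈ʳ (extendʳ (τ.commute (T.F ₁ f))) ⟩
          G ₁ (π* · Y) ∘ G ₁ (S.F ₁ (T.F ₁ f)) ∘ τ · (T.F ₀ X) ∘ S.F ₁ (σ · X) ∘ ι* · (G ₀ X)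
            ≈⟨ extendʳ (G.F-square (π*.commute f)) ⟩
          G ₁ ([ST] ₁ f) ∘ G ₁ (π* · X) ∘ τ · (T.F ₀ X) ∘ S.F ₁ (σ · X) ∘ ι* · (G ₀ X) ∎
      }

module _ {C : Category o ℓ e} (T S : Monad C) (G : Endofunctor C)
         (δ : NaturalTransformation (Monad.F T ∘F Monad.F S) (Monad.F S ∘F Monad.F T))
         (σ : NaturalTransformation (Monad.F T ∘F G) (G ∘F Monad.F T))
         (τ : NaturalTransformation (Monad.F S ∘F G) (G ∘F Monad.F S)) where
  open Category C
  private
    module T = Monad T
    module S = Monad S

  YangBaxter : Set (o ⊔ e)
  YangBaxter = ∀ X → τ · (T.F ₀ X) ∘ S.F ₁ (σ · X) ∘ δ · (G ₀ X) ≈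
                     G ₁ (δ · X) ∘ σ · (S.F ₀ X) ∘ T.F ₁ (τ · X)

{-# OPTIONS --safe #-}
module Submission where

-- Write λ̃ = τT ∘ Sσ : STG ⇒ GST, so that λ = Gπ* ∘ λ̃ ∘ ι*G, and let
-- m = μˢT ∘ SSμᵀ ∘ SδT : STST ⇒ ST. Naturality of the correspondence between δ
-- and the lifting gives ι* ∘ μ = m ∘ STι* ∘ ι*[ST] and μ ∘ π*[ST] ∘ STπ* = π* ∘ m,
-- where μ is the multiplication of the composite monad, while the Yang–Baxter
-- condition gives λ̃ ∘ mG = Gm ∘ λ̃ST ∘ STλ̃. Pasting the three squares proves the
-- multiplication axiom for λ; no idempotent ι* ∘ π* ever has to be commuted with λ̃.

open import Defs
open import Level using (Level)
open import Data.Product using (_×_; _,_)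

module _ {o ℓ e : Level} {C : Category o ℓ e} (T S : Monad C) where
  open Category C
  open HomReasoning
  private
    module T = Monad T
    module S = Monad S

  -- Comparing the composite monad with the multiplication on `ST`.

  module _ (δ : NaturalTransformation (T.F ∘F S.F) (S.F ∘F T.F)) where
    private
      module δ = NaturalTransformation δ

    -- When `δ` is also compatible with the unit of `T`, this is the multiplication of the usual
    -- composite monad on `ST`. For a weak law the unit of `T` followed by that of `S` need not be a
    -- unit for it.
    multiplicationST : ∀ X → S.F ₀ (T.F ₀ (S.F ₀ (T.F ₀ X))) ⇒ S.F ₀ (T.F ₀ X)
    multiplicationST X =
      S.μ · (T.F ₀ X) ∘ S.F ₁ (S.F ₁ (T.μ · X)) ∘ S.F ₁ (δ · (T.F ₀ X))

    module _ (lifting : WeakLifting S T)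
             (corresponding : IsCorrespondingLifting T S δ lifting) where
      open WeakLifting lifting
      open Algebra
      open AlgebraHom
      private
        Ŝᵀ : Obj → Algebra T
        Ŝᵀ X = Ŝ.F ₀ (Free T ₀ X)
        ε : ∀ A → Category._⇒_ (EM T) (Free T ₀ (carrier A)) A
        ε A = Adjunction.counit (Free⊣Forgetful T) · A
        module ST = Monad (compositeMonad lifting)

      -- The correspondence expresses `δ` through the lifting at free algebras only. Transporting
      -- that formula along the counit `ε A` gives it at every algebra: what remains on the right is
      -- `T S` applied to the unit law of `A`.
      ι-structure-π : ∀ A →
        ι · A ∘ structure (Ŝ.F ₀ A) ∘ T.F ₁ (π · A) ≈
        S.F ₁ (structure A) ∘ δ · (carrier A)
      ι-structure-π A = Equiv.sym (begin
        S.F ₁ a ∘ δ · X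
          ≈⟨ ∘-resp-≈ʳ (corresponding X) ⟩
        S.F ₁ a ∘ ι · F ∘ structure (Ŝ.F ₀ F) ∘ T.F ₁ (π · F) ∘ T.F ₁ (S.F ₁ (T.η · X))
          -- The underlying map of `ε A` is `a` itself, so `S a` passes through `ι` as the lifted
          -- morphism, which in turn commutes with the lifted structures.
          ≈⟨ extendʳ (Equiv.sym (ι.commute (ε A))) ⟩
        ι · A ∘ arr (Ŝ.F ₁ (ε A)) ∘ structure (Ŝ.F ₀ F) ∘ T.F ₁ (π · F) ∘ T.F ₁ (S.F ₁ (T.η · X))
          ≈⟨ ∘-resp-≈ʳ (extendʳ (commutes (Ŝ.F ₁ (ε A)))) ⟩
        ι · A ∘ structure (Ŝ.F ₀ A) ∘ T.F ₁ (arr (Ŝ.F ₁ (ε A))) ∘ T.F ₁ (π · F) ∘ T.F ₁ (S.F ₁ (T.η · X))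
          ≈⟨ ∘-resp-≈ʳ (∘-resp-≈ʳ (extendʳ (T.F-square (Equiv.sym (π.commute (ε A)))))) ⟩
        ι · A ∘ structure (Ŝ.F ₀ A) ∘ T.F ₁ (π · A) ∘ T.F ₁ (S.F ₁ a) ∘ T.F ₁ (S.F ₁ (T.η · X))
          ≈⟨ ∘-resp-≈ʳ (∘-resp-≈ʳ (∘-resp-≈ʳ TSa∘TSη≈id)) ⟩
        ι · A ∘ structure (Ŝ.F ₀ A) ∘ T.F ₁ (π · A) ∘ id
          ≈⟨ ∘-resp-≈ʳ (∘-resp-≈ʳ identityʳ) ⟩
        ι · A ∘ structure (Ŝ.F ₀ A) ∘ T.F ₁ (π · A) ∎)
        where
        a = structure A
        X = carrier A
        F = Free T ₀ X
        TSa∘TSη≈id : T.F ₁ (S.F ₁ a) ∘ T.F ₁ (S.F ₁ (T.η · X)) ≈ id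
        TSa∘TSη≈id =
          Equiv.trans (T.F-triangle (S.F-triangle (alg-unit A)))
            (Equiv.trans (T.F-resp-≈ S.identity) T.identity)

      -- `S a ∘ δ` is an associative, possibly non-unital, action on `S` of the carrier, and `ι` is
      -- equivariant into it. Since `π ∘ ι` is the identity, composing `ι-structure-π` with `T ι`
      -- removes `π`; `structure-π` is the dual statement.
      ι-structure : ∀ A →
        ι · A ∘ structure (Ŝ.F ₀ A) ≈
        (S.F ₁ (structure A) ∘ δ · (carrier A)) ∘ T.F ₁ (ι · A)
      ι-structure A = begin
        ι · A ∘ structure (Ŝ.F ₀ A)
          ≈⟨ ∘-resp-≈ʳ identityʳ ⟨
        ι · A ∘ structure (Ŝ.F ₀ A) ∘ id
          ≈⟨ ∘-resp-≈ʳ (∘-resp-≈ʳ (Equiv.trans (T.F-triangle (π-ι A)) T.identity)) ⟨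
        ι · A ∘ structure (Ŝ.F ₀ A) ∘ T.F ₁ (π · A) ∘ T.F ₁ (ι · A)
          ≈⟨ Equiv.trans assoc (∘-resp-≈ʳ assoc) ⟨
        (ι · A ∘ structure (Ŝ.F ₀ A) ∘ T.F ₁ (π · A)) ∘ T.F ₁ (ι · A)
          ≈⟨ ∘-resp-≈ˡ (ι-structure-π A) ⟩
        (S.F ₁ (structure A) ∘ δ · (carrier A)) ∘ T.F ₁ (ι · A) ∎

      structure-π : ∀ A →
        structure (Ŝ.F ₀ A) ∘ T.F ₁ (π · A) ≈
        π · A ∘ S.F ₁ (structure A) ∘ δ · (carrier A)
      structure-π A = begin
        structure (Ŝ.F ₀ A) ∘ T.F ₁ (π · A)
          ≈⟨ cancelˡ (π-ι A) ⟨
        π · A ∘ ι · A ∘ structure (Ŝ.F ₀ A) ∘ T.F ₁ (π · A)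
          ≈⟨ ∘-resp-≈ʳ (ι-structure-π A) ⟩
        π · A ∘ S.F ₁ (structure A) ∘ δ · (carrier A) ∎

      -- `ι-μ` replaces the lifted multiplication by that of `S`. Naturality of `ι` at the counit
      -- then leaves the structure map of the lifted free algebra under `S`, and equivariance of `ι`
      -- turns it into `T.μ` after `δ`.
      ι*-multiplication : ∀ X →
        ι* lifting · X ∘ ST.μ · X ≈
        multiplicationST X ∘ S.F ₁ (T.F ₁ (ι* lifting · X)) ∘ ι* lifting · (ST.F ₀ X)
      ι*-multiplication X = begin
        ι · F ∘ arr (Ŝ.μ · F) ∘ arr (Ŝ.F ₁ (ε (Ŝᵀ X)))
          ≈⟨ pullˡ (ι-μ F) ⟩
        (S.μ · _ ∘ S.F ₁ (ι · F) ∘ ι · (Ŝᵀ X)) ∘ arr (Ŝ.F ₁ (ε (Ŝᵀ X)))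
          ≈⟨ Equiv.trans assoc (∘-resp-≈ʳ assoc) ⟩
        S.μ · _ ∘ S.F ₁ (ι · F) ∘ ι · (Ŝᵀ X) ∘ arr (Ŝ.F ₁ (ε (Ŝᵀ X)))
          ≈⟨ ∘-resp-≈ʳ (∘-resp-≈ʳ (ι.commute (ε (Ŝᵀ X)))) ⟩
        S.μ · _ ∘ S.F ₁ (ι · F) ∘ S.F ₁ (structure (Ŝᵀ X)) ∘ ι · _
          ≈⟨ ∘-resp-≈ʳ (extendʳ (S.F-square (ι-structure F))) ⟩
        S.μ · _ ∘ S.F ₁ (S.F ₁ (T.μ · X) ∘ δ · _) ∘ S.F ₁ (T.F ₁ (ι · F)) ∘ ι · _
          ≈⟨ ∘-resp-≈ʳ (∘-resp-≈ˡ S.homomorphism) ⟩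
        S.μ · _ ∘ (S.F ₁ (S.F ₁ (T.μ · X)) ∘ S.F ₁ (δ · _)) ∘ S.F ₁ (T.F ₁ (ι · F)) ∘ ι · _
          ≈⟨ assoc ⟨
        multiplicationST X ∘ S.F ₁ (T.F ₁ (ι · F)) ∘ ι · _ ∎
        where F = Free T ₀ X

      -- The mirror image of the argument for `ι*`: naturality of `π` at the counit, then
      -- `structure-π` under `S`, then `π-μ`.
      multiplication-π* : ∀ X →
        ST.μ · X ∘ π* lifting · (ST.F ₀ X) ∘ S.F ₁ (T.F ₁ (π* lifting · X)) ≈
        π* lifting · X ∘ multiplicationST X
      multiplication-π* X = begin
        (arr (Ŝ.μ · F) ∘ arr (Ŝ.F ₁ (ε (Ŝᵀ X)))) ∘ π · _ ∘ S.F ₁ (T.F ₁ (π · F))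
          ≈⟨ assoc ⟩
        arr (Ŝ.μ · F) ∘ arr (Ŝ.F ₁ (ε (Ŝᵀ X))) ∘ π · _ ∘ S.F ₁ (T.F ₁ (π · F))
          ≈⟨ ∘-resp-≈ʳ (extendʳ (Equiv.sym (π.commute (ε (Ŝᵀ X))))) ⟩
        arr (Ŝ.μ · F) ∘ π · (Ŝᵀ X) ∘ S.F ₁ (structure (Ŝᵀ X)) ∘ S.F ₁ (T.F ₁ (π · F))
          ≈⟨ ∘-resp-≈ʳ (∘-resp-≈ʳ (S.F-square (structure-π F))) ⟩
        arr (Ŝ.μ · F) ∘ π · (Ŝᵀ X) ∘ S.F ₁ (π · F) ∘ S.F ₁ (S.F ₁ (T.μ · X) ∘ δ · _)
          ≈⟨ Equiv.trans assoc (∘-resp-≈ʳ assoc) ⟨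
        (arr (Ŝ.μ · F) ∘ π · (Ŝᵀ X) ∘ S.F ₁ (π · F)) ∘ S.F ₁ (S.F ₁ (T.μ · X) ∘ δ · _)
          ≈⟨ ∘-resp-≈ (π-μ F) S.homomorphism ⟩
        (π · F ∘ S.μ · _) ∘ S.F ₁ (S.F ₁ (T.μ · X)) ∘ S.F ₁ (δ · _)
          ≈⟨ assoc ⟩
        π · F ∘ multiplicationST X ∎
        where F = Free T ₀ X

  -- The law of `ST` over `G`.

  module _ {G : Endofunctor C}
           (σ : NaturalTransformation (T.F ∘F G) (G ∘F T.F))
           (τ : NaturalTransformation (S.F ∘F G) (G ∘F S.F)) where
    private
      module G = Functor G
      module σ = NaturalTransformation σ
      module τ = NaturalTransformation τ

    lawST : ∀ X → S.F ₀ (T.F ₀ (G ₀ X)) ⇒ G ₀ (S.F ₀ (T.F ₀ X))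
    lawST X = τ · (T.F ₀ X) ∘ S.F ₁ (σ · X)

    lawST-natural : ∀ {X Y} (f : X ⇒ Y) →
      lawST Y ∘ S.F ₁ (T.F ₁ (G ₁ f)) ≈ G ₁ (S.F ₁ (T.F ₁ f)) ∘ lawST X
    lawST-natural {X} {Y} f = begin
      (τ · _ ∘ S.F ₁ (σ · Y)) ∘ S.F ₁ (T.F ₁ (G ₁ f))   ≈⟨ assoc ⟩
      τ · _ ∘ S.F ₁ (σ · Y) ∘ S.F ₁ (T.F ₁ (G ₁ f))     ≈⟨ ∘-resp-≈ʳ (S.F-square (σ.commute f)) ⟩
      τ · _ ∘ S.F ₁ (G ₁ (T.F ₁ f)) ∘ S.F ₁ (σ · X)     ≈⟨ extendʳ (τ.commute (T.F ₁ f)) ⟩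
      G ₁ (S.F ₁ (T.F ₁ f)) ∘ τ · _ ∘ S.F ₁ (σ · X)     ∎

    -- Naturality of `δ` at `σ` moves `σ` in front of `δ`, which exposes one side of the Yang-Baxter
    -- equation at `T X`; the displaced `σ` then joins `τ` to form `lawST` under `T`.
    lawST-δ : (δ : NaturalTransformation (T.F ∘F S.F) (S.F ∘F T.F)) →
      YangBaxter T S G δ σ τ → ∀ X →
      lawST (T.F ₀ X) ∘ S.F ₁ (T.F ₁ (σ · X)) ∘ δ · (T.F ₀ (G ₀ X)) ≈
      G ₁ (δ · (T.F ₀ X)) ∘ σ · (S.F ₀ (T.F ₀ X)) ∘ T.F ₁ (lawST X)
    lawST-δ δ yang-baxter X = begin
      (τ · _ ∘ S.F ₁ (σ · _)) ∘ S.F ₁ (T.F ₁ (σ · X)) ∘ δ · _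
        ≈⟨ ∘-resp-≈ʳ (NaturalTransformation.commute δ (σ · X)) ⟨
      (τ · _ ∘ S.F ₁ (σ · _)) ∘ δ · _ ∘ T.F ₁ (S.F ₁ (σ · X))
        ≈⟨ pullˡ (Equiv.trans assoc (yang-baxter (T.F ₀ X))) ⟩
      (G ₁ (δ · _) ∘ σ · _ ∘ T.F ₁ (τ · _)) ∘ T.F ₁ (S.F ₁ (σ · X))
        ≈⟨ Equiv.trans assoc (∘-resp-≈ʳ assoc) ⟩
      G ₁ (δ · _) ∘ σ · _ ∘ T.F ₁ (τ · _) ∘ T.F ₁ (S.F ₁ (σ · X))
        ≈⟨ ∘-resp-≈ʳ (∘-resp-≈ʳ T.homomorphism) ⟨
      G ₁ (δ · _) ∘ σ · _ ∘ T.F ₁ (lawST X) ∎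

    -- The factors of the multiplication are passed one at a time: `S.μ` by the law for `τ`, `T.μ`
    -- by the law for `σ`, and `δ` by Yang-Baxter. The last two take place under an outer `S`.
    lawST-multiplication :
      (δ : NaturalTransformation (T.F ∘F S.F) (S.F ∘F T.F)) →
      IsWeakDistributiveLawOver T G σ → IsWeakDistributiveLawOver S G τ →
      YangBaxter T S G δ σ τ → ∀ X →
      lawST X ∘ multiplicationST δ (G ₀ X) ≈
      G ₁ (multiplicationST δ X) ∘ lawST (S.F ₀ (T.F ₀ X)) ∘ S.F ₁ (T.F ₁ (lawST X))
    lawST-multiplication δ σ-law τ-law yang-baxter X = begin
      (τ · _ ∘ S.F ₁ (σ · X)) ∘ S.μ · _ ∘ S.F ₁ (S.F ₁ (T.μ · _)) ∘ S.F ₁ (δ · _)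
        ≈⟨ assoc ⟩
      τ · _ ∘ S.F ₁ (σ · X) ∘ S.μ · _ ∘ S.F ₁ (S.F ₁ (T.μ · _)) ∘ S.F ₁ (δ · _)
        ≈⟨ ∘-resp-≈ʳ (extendʳ (Equiv.sym (S.μ.commute (σ · X)))) ⟩
      τ · _ ∘ S.μ · _ ∘ S.F ₁ (S.F ₁ (σ · X)) ∘ S.F ₁ (S.F ₁ (T.μ · _)) ∘ S.F ₁ (δ · _)
        ≈⟨ pullˡ (τ-law (T.F ₀ X)) ⟩
      (G ₁ (S.μ · _) ∘ τ · _ ∘ S.F ₁ (τ · _))
        ∘ S.F ₁ (S.F ₁ (σ · X)) ∘ S.F ₁ (S.F ₁ (T.μ · _)) ∘ S.F ₁ (δ · _)
        ≈⟨ Equiv.trans assoc (∘-resp-≈ʳ assoc) ⟩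
      G ₁ (S.μ · _) ∘ τ · _ ∘ S.F ₁ (τ · _)
        ∘ S.F ₁ (S.F ₁ (σ · X)) ∘ S.F ₁ (S.F ₁ (T.μ · _)) ∘ S.F ₁ (δ · _)
        ≈⟨ ∘-resp-≈ʳ (∘-resp-≈ʳ collect) ⟩
      G ₁ (S.μ · _) ∘ τ · _ ∘ S.F ₁ (G ₁ (S.F ₁ (T.μ · X) ∘ δ · _))
        ∘ S.F ₁ (σ · _) ∘ S.F ₁ (T.F ₁ (lawST X))
        -- Naturality of `τ` brings `G` outside `S`, so that the two maps under `G` reassemble into
        -- `multiplicationST`.
        ≈⟨ ∘-resp-≈ʳ (extendʳ (τ.commute _)) ⟩
      G ₁ (S.μ · _) ∘ G ₁ (S.F ₁ (S.F ₁ (T.μ · X) ∘ δ · _)) ∘ τ · _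
        ∘ S.F ₁ (σ · _) ∘ S.F ₁ (T.F ₁ (lawST X))
        ≈⟨ pullˡ (G.F-triangle (∘-resp-≈ʳ S.homomorphism)) ⟩
      G ₁ (multiplicationST δ X) ∘ τ · _ ∘ S.F ₁ (σ · _) ∘ S.F ₁ (T.F ₁ (lawST X))
        ≈⟨ ∘-resp-≈ʳ assoc ⟨
      G ₁ (multiplicationST δ X) ∘ lawST _ ∘ S.F ₁ (T.F ₁ (lawST X)) ∎
      where
      -- The part beneath the outer `S`: the law for `σ` expands `σ` after `T.μ`, naturality of `τ`
      -- carries `T.μ` to the left, and the rest is `lawST-δ`.
      step :
        τ · _ ∘ S.F ₁ (σ · X) ∘ S.F ₁ (T.μ · _) ∘ δ · _ ≈
        G ₁ (S.F ₁ (T.μ · X) ∘ δ · _) ∘ σ · _ ∘ T.F ₁ (lawST X)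
      step = begin
        τ · _ ∘ S.F ₁ (σ · X) ∘ S.F ₁ (T.μ · _) ∘ δ · _
          ≈⟨ ∘-resp-≈ʳ (pullˡ (S.F-triangle (σ-law X))) ⟩
        τ · _ ∘ S.F ₁ (G ₁ (T.μ · X) ∘ σ · _ ∘ T.F ₁ (σ · X)) ∘ δ · _
          ≈⟨ ∘-resp-≈ʳ (Equiv.trans (pushˡ S.homomorphism)
               (∘-resp-≈ʳ (pushˡ S.homomorphism))) ⟩
        τ · _ ∘ S.F ₁ (G ₁ (T.μ · X)) ∘ S.F ₁ (σ · _) ∘ S.F ₁ (T.F ₁ (σ · X)) ∘ δ · _
          ≈⟨ extendʳ (τ.commute (T.μ · X)) ⟩
        G ₁ (S.F ₁ (T.μ · X)) ∘ τ · _ ∘ S.F ₁ (σ · _) ∘ S.F ₁ (T.F ₁ (σ · X)) ∘ δ · _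
          ≈⟨ ∘-resp-≈ʳ assoc ⟨
        G ₁ (S.F ₁ (T.μ · X)) ∘ lawST _ ∘ S.F ₁ (T.F ₁ (σ · X)) ∘ δ · _
          ≈⟨ ∘-resp-≈ʳ (lawST-δ δ yang-baxter X) ⟩
        G ₁ (S.F ₁ (T.μ · X)) ∘ G ₁ (δ · _) ∘ σ · _ ∘ T.F ₁ (lawST X)
          ≈⟨ pullˡ (Equiv.sym G.homomorphism) ⟩
        G ₁ (S.F ₁ (T.μ · X) ∘ δ · _) ∘ σ · _ ∘ T.F ₁ (lawST X) ∎

      collect :
        S.F ₁ (τ · _) ∘ S.F ₁ (S.F ₁ (σ · X)) ∘ S.F ₁ (S.F ₁ (T.μ · _)) ∘ S.F ₁ (δ · _) ≈
        S.F ₁ (G ₁ (S.F ₁ (T.μ · X) ∘ δ · _)) ∘ S.F ₁ (σ · _) ∘ S.F ₁ (T.F ₁ (lawST X))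
      collect = begin
        S.F ₁ (τ · _) ∘ S.F ₁ (S.F ₁ (σ · X)) ∘ S.F ₁ (S.F ₁ (T.μ · _)) ∘ S.F ₁ (δ · _)
          ≈⟨ ∘-resp-≈ʳ (∘-resp-≈ʳ S.homomorphism) ⟨
        S.F ₁ (τ · _) ∘ S.F ₁ (S.F ₁ (σ · X)) ∘ S.F ₁ (S.F ₁ (T.μ · _) ∘ δ · _)
          ≈⟨ ∘-resp-≈ʳ S.homomorphism ⟨
        S.F ₁ (τ · _) ∘ S.F ₁ (S.F ₁ (σ · X) ∘ S.F ₁ (T.μ · _) ∘ δ · _)
          ≈⟨ S.F-square step ⟩
        S.F ₁ (G ₁ (S.F ₁ (T.μ · X) ∘ δ · _)) ∘ S.F ₁ (σ · _ ∘ T.F ₁ (lawST X))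
          ≈⟨ ∘-resp-≈ʳ S.homomorphism ⟩
        S.F ₁ (G ₁ (S.F ₁ (T.μ · X) ∘ δ · _)) ∘ S.F ₁ (σ · _) ∘ S.F ₁ (T.F ₁ (lawST X)) ∎

    lawST-unit : IsStrong T G σ → IsStrong S G τ → ∀ X →
      lawST X ∘ S.η · (T.F ₀ (G ₀ X)) ∘ T.η · (G ₀ X) ≈
      G ₁ (S.η · (T.F ₀ X)) ∘ G ₁ (T.η · X)
    lawST-unit σ-strong τ-strong X = begin
      (τ · _ ∘ S.F ₁ (σ · X)) ∘ S.η · _ ∘ T.η · _   ≈⟨ assoc ⟩
      τ · _ ∘ S.F ₁ (σ · X) ∘ S.η · _ ∘ T.η · _
        ≈⟨ ∘-resp-≈ʳ (extendʳ (Equiv.sym (S.η.commute (σ · X)))) ⟩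
      τ · _ ∘ S.η · _ ∘ σ · X ∘ T.η · _
        ≈⟨ pullˡ (τ-strong (T.F ₀ X)) ⟩
      G ₁ (S.η · _) ∘ σ · X ∘ T.η · _               ≈⟨ ∘-resp-≈ʳ (σ-strong X) ⟩
      G ₁ (S.η · _) ∘ G ₁ (T.η · X)                 ∎

    -- Passing from `ST` to the composite monad.

    module _ (lifting : WeakLifting S T) where
      open WeakLifting lifting using (ι-η; π-η)
      private
        module ST = Monad (compositeMonad lifting)
        ι*′ = ι* lifting
        π*′ = π* lifting
        λ* = compositeLaw lifting {G} σ τ

      compositeLaw-lawST : ∀ X → λ* · X ≈ G ₁ (π*′ · X) ∘ lawST X ∘ ι*′ · (G ₀ X)
      compositeLaw-lawST X = ∘-resp-≈ʳ (Equiv.sym assoc)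

      compositeLaw-multiplication :
        (δ : NaturalTransformation (T.F ∘F S.F) (S.F ∘F T.F)) →
        IsCorrespondingLifting T S δ lifting →
        IsWeakDistributiveLawOver T G σ → IsWeakDistributiveLawOver S G τ →
        YangBaxter T S G δ σ τ →
        IsWeakDistributiveLawOver (compositeMonad lifting) G λ*
      compositeLaw-multiplication δ corresponding σ-law τ-law yang-baxter X = begin
        λ* · X ∘ ST.μ · (G ₀ X)
          ≈⟨ pushˡ (compositeLaw-lawST X) ⟩
        G ₁ p ∘ (lawST X ∘ i) ∘ ST.μ · (G ₀ X)
          ≈⟨ ∘-resp-≈ʳ assoc ⟩
        G ₁ p ∘ lawST X ∘ i ∘ ST.μ · (G ₀ X)
          ≈⟨ ∘-resp-≈ʳ (∘-resp-≈ʳ (ι*-multiplication δ lifting corresponding (G ₀ X))) ⟩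
        G ₁ p ∘ lawST X ∘ multiplicationST δ (G ₀ X) ∘ S.F ₁ (T.F ₁ i) ∘ ι*′ · _
          ≈⟨ ∘-resp-≈ʳ (pullˡ (lawST-multiplication δ σ-law τ-law yang-baxter X)) ⟩
        G ₁ p ∘ (G ₁ (multiplicationST δ X) ∘ lawST _ ∘ S.F ₁ (T.F ₁ (lawST X)))
          ∘ S.F ₁ (T.F ₁ i) ∘ ι*′ · _
          ≈⟨ ∘-resp-≈ʳ (Equiv.trans assoc (∘-resp-≈ʳ assoc)) ⟩
        G ₁ p ∘ G ₁ (multiplicationST δ X) ∘ lawST _ ∘ S.F ₁ (T.F ₁ (lawST X))
          ∘ S.F ₁ (T.F ₁ i) ∘ ι*′ · _
          -- Read backwards, the square for `π*` produces a copy of `p` under `S T`. Naturality of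
          -- `lawST` then moves it rightwards to meet `lawST X` and `i`, the other two factors of
          -- the composite law.
          ≈⟨ extendʳ (G.F-square (Equiv.sym (multiplication-π* δ lifting corresponding X))) ⟩
        G ₁ (ST.μ · X) ∘ G ₁ (π*′ · _ ∘ S.F ₁ (T.F ₁ p)) ∘ lawST _
          ∘ S.F ₁ (T.F ₁ (lawST X)) ∘ S.F ₁ (T.F ₁ i) ∘ ι*′ · _
          ≈⟨ ∘-resp-≈ʳ (pushˡ G.homomorphism) ⟩
        G ₁ (ST.μ · X) ∘ G ₁ (π*′ · _) ∘ G ₁ (S.F ₁ (T.F ₁ p)) ∘ lawST _
          ∘ S.F ₁ (T.F ₁ (lawST X)) ∘ S.F ₁ (T.F ₁ i) ∘ ι*′ · _
          ≈⟨ ∘-resp-≈ʳ (∘-resp-≈ʳ (extendʳ (Equiv.sym (lawST-natural p)))) ⟩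
        G ₁ (ST.μ · X) ∘ G ₁ (π*′ · _) ∘ lawST _ ∘ S.F ₁ (T.F ₁ (G ₁ p))
          ∘ S.F ₁ (T.F ₁ (lawST X)) ∘ S.F ₁ (T.F ₁ i) ∘ ι*′ · _
          ≈⟨ ∘-resp-≈ʳ (∘-resp-≈ʳ (∘-resp-≈ʳ fuse)) ⟩
        G ₁ (ST.μ · X) ∘ G ₁ (π*′ · _) ∘ lawST _ ∘ S.F ₁ (T.F ₁ (λ* · X)) ∘ ι*′ · _
          -- Naturality of `ι*` converts the action of `ST` on the law into that of the composite
          -- functor.
          ≈⟨ ∘-resp-≈ʳ (∘-resp-≈ʳ (∘-resp-≈ʳ
               (NaturalTransformation.commute ι*′ (λ* · X)))) ⟨
        G ₁ (ST.μ · X) ∘ G ₁ (π*′ · _) ∘ lawST _ ∘ ι*′ · _ ∘ ST.F ₁ (λ* · X)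
          ≈⟨ ∘-resp-≈ʳ (Equiv.trans assoc (∘-resp-≈ʳ assoc)) ⟨
        G ₁ (ST.μ · X) ∘ (G ₁ (π*′ · _) ∘ lawST _ ∘ ι*′ · _) ∘ ST.F ₁ (λ* · X)
          ≈⟨ ∘-resp-≈ʳ (∘-resp-≈ˡ (compositeLaw-lawST (ST.F ₀ X))) ⟨
        G ₁ (ST.μ · X) ∘ λ* · (ST.F ₀ X) ∘ ST.F ₁ (λ* · X) ∎
        where
        i = ι*′ · (G ₀ X)
        p = π*′ · X
        fuse :
          S.F ₁ (T.F ₁ (G ₁ p)) ∘ S.F ₁ (T.F ₁ (lawST X)) ∘ S.F ₁ (T.F ₁ i) ∘ ι*′ · _ ≈
          S.F ₁ (T.F ₁ (λ* · X)) ∘ ι*′ · _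
        fuse = begin
          S.F ₁ (T.F ₁ (G ₁ p)) ∘ S.F ₁ (T.F ₁ (lawST X)) ∘ S.F ₁ (T.F ₁ i) ∘ ι*′ · _
            ≈⟨ ∘-resp-≈ʳ (pullˡ (S.F-triangle (T.F-triangle Equiv.refl))) ⟩
          S.F ₁ (T.F ₁ (G ₁ p)) ∘ S.F ₁ (T.F ₁ (lawST X ∘ i)) ∘ ι*′ · _
            ≈⟨ pullˡ (S.F-triangle (T.F-triangle (Equiv.sym (compositeLaw-lawST X)))) ⟩
          S.F ₁ (T.F ₁ (λ* · X)) ∘ ι*′ · _ ∎

      -- `ι-η` turns the composite unit into the units of `T` and `S`, strength of `σ` and `τ`
      -- carries these under `G`, and `π-η` reassembles the composite unit there.
      compositeLaw-strong : IsStrong T G σ → IsStrong S G τ →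
        IsStrong (compositeMonad lifting) G λ*
      compositeLaw-strong σ-strong τ-strong X = begin
        λ* · X ∘ ST.η · (G ₀ X)
          ≈⟨ pushˡ (compositeLaw-lawST X) ⟩
        G ₁ (π*′ · X) ∘ (lawST X ∘ ι*′ · _) ∘ ST.η · (G ₀ X)
          ≈⟨ ∘-resp-≈ʳ assoc ⟩
        G ₁ (π*′ · X) ∘ lawST X ∘ ι*′ · _ ∘ ST.η · (G ₀ X)
          ≈⟨ ∘-resp-≈ʳ (∘-resp-≈ʳ (pullˡ (ι-η (Free T ₀ (G ₀ X))))) ⟩
        G ₁ (π*′ · X) ∘ lawST X ∘ S.η · _ ∘ T.η · (G ₀ X)
          ≈⟨ ∘-resp-≈ʳ (lawST-unit σ-strong τ-strong X) ⟩
        G ₁ (π*′ · X) ∘ G ₁ (S.η · _) ∘ G ₁ (T.η · X)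
          ≈⟨ pullˡ (G.F-triangle (π-η (Free T ₀ X))) ⟩
        G ₁ (AlgebraHom.arr (WeakLifting.Ŝ.η lifting · (Free T ₀ X))) ∘ G ₁ (T.η · X)
          ≈⟨ G.homomorphism ⟨
        G ₁ (ST.η · X) ∎

-- A lifting is determined by `δ` only up to the choice of splittings, so the result is stated for
-- every corresponding one. `LiftingOf` constructs such a lifting when idempotents split.
theorem13 : ∀ {o ℓ e : Level} (C : Category o ℓ e) → IdempotentsSplit C →
    (T S : Monad C) (G : Endofunctor C)
    (δ : NaturalTransformation (Monad.F T ∘F Monad.F S) (Monad.F S ∘F Monad.F T))
    (σ : NaturalTransformation (Monad.F T ∘F G) (G ∘F Monad.F T))
    (τ : NaturalTransformation (Monad.F S ∘F G) (G ∘F Monad.F S)) →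
    IsWeakDistributiveLaw T S δ →
    IsWeakDistributiveLawOver T G σ →
    IsWeakDistributiveLawOver S G τ →
    YangBaxter T S G δ σ τ →
    (lifting : WeakLifting S T) → IsCorrespondingLifting T S δ lifting →
    IsWeakDistributiveLawOver (compositeMonad lifting) G (compositeLaw lifting σ τ)
    × (IsStrong T G σ → IsStrong S G τ →
    IsStrong (compositeMonad lifting) G (compositeLaw lifting σ τ))
theorem13 C _ T S G δ σ τ _ σ-law τ-law yang-baxter lifting corresponding =
  compositeLaw-multiplication T S σ τ lifting δ corresponding σ-law τ-law yang-baxter ,
  compositeLaw-strong T S σ τ lifting
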